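{- Let $\ell\geq 0$. For every $u,v\in S_{\infty,\ell}$ there exists $w\in S_{\infty,\ell}$ with $u\preceq_D w$ and $v\preceq_D w$.
   Context: $S_\infty=\bigcup_{n\geq1}S_n$ via the inclusions $S_n\hookrightarrow S_{n+1}$, $w(1)\cdots w(n)\mapsto w(1)\cdots w(n)\,(n+1)$; $\ell(w)$ is the number of inversions and $S_{\infty,\ell}=\{w\in S_\infty:\ell(w)=\ell\}$. Schubert polynomials: with $\partial_i f=\frac{f-s_if}{x_i-x_{i+1}}$, for $w\in S_n$ set $\mathfrak{S}_{w_0}=x_1^{n-1}x_2^{n-2}\cdots x_{n-1}$ for $w_0=n\,n{ - }1\cdots1$ and $\mathfrak{S}_w=\partial_i\mathfrak{S}_{ws_i}$ whenever $w(i)<w(i+1)$ (with $ws_i$ being $w$ with positions $i,i+1$ of its one-line notation swapped); this is well defined on $S_\infty$. $\mathsf{Newton}(f)$ is the convex hull of the exponent vectors of $f$, viewed in $\mathbb{R}^N$ for any $N$ at least the number of variables involved. For $u,v\in S_{\infty,\ell}$, $u\preceq_D v$ means $\mathsf{Newton}(\mathfrak{S}_u)\subseteq\mathsf{Newton}(\mathfrak{S}_v)$. -}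

module Defs where

open import Data.Nat using (ℕ; zero; suc; _∸_; _*_; _<?_; _≡ᵇ_; _<ᵇ_)
open import Data.Nat.Properties using (≤ᵇ⇒≤)
open import Data.Bool using (Bool; true; false; if_then_else_; _∧_; not)
open import Data.Integer using (ℤ; -_) renaming (+_ to ⁺_; _+_ to _+ℤ_)
import Data.Integer as ℤ
open import Data.Rational using (ℚ; 0ℚ; 1ℚ; _/_) renaming (_+_ to _+ℚ_; _*_ to _*ℚ_; _≤_ to _≤ℚ_)
open import Data.List using (List; []; _∷_; _++_; map; filter; length; upTo; allFin; reverse; foldr; concatMap)
open import Data.List.Relation.Unary.All using (All)
open import Data.List.Membership.Propositional using (_∈_)
open import Data.Maybe using (Maybe; just; nothing)
open import Data.Product using (_×_; _,_; Σ; proj₁; proj₂)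
open import Data.Fin using (Fin; toℕ)
open import Data.Fin.Permutation using (Permutation′; _⟨$⟩ʳ_)
open import Relation.Binary.PropositionalEquality using (_≡_)

oneLine : ∀ {n} → Permutation′ n → List ℕ
oneLine {n} w = map (λ i → toℕ (w ⟨$⟩ʳ i)) (allFin n)

inversions : List ℕ → ℕ
inversions []       = 0
inversions (x ∷ xs) = length (filter (λ y → y <? x) xs) Data.Nat.+ inversions xs

len : ∀ {n} → Permutation′ n → ℕ
len w = inversions (oneLine w)

firstAscent : List ℕ → Maybe ℕ
firstAscent []           = nothing
firstAscent (x ∷ [])     = nothing
firstAscent (x ∷ y ∷ xs) = if x <ᵇ y then just 0 else go (firstAscent (y ∷ xs))
  where
  go : Maybe ℕ → Maybe ℕ
  go nothing  = nothing
  go (just i) = just (suc i)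

swapAt : ℕ → List ℕ → List ℕ
swapAt zero    (x ∷ y ∷ xs) = y ∷ x ∷ xs
swapAt (suc i) (x ∷ xs)     = x ∷ swapAt i xs
swapAt _       xs           = xs

-- Polynomials in x_1, x_2, ... with integer coefficients, as formal
-- (unnormalised) sums of terms  c · x^e,  e a finite exponent list
-- (entry k = exponent of x_{k+1}; missing entries are 0).

Exp : Set
Exp = List ℕ

Poly : Set
Poly = List (ℤ × Exp)

expAt : Exp → ℕ → ℕ
expAt []       _       = 0
expAt (a ∷ as) zero    = a
expAt (a ∷ as) (suc k) = expAt as k

setAt : Exp → ℕ → ℕ → Exp
setAt []       zero    v = v ∷ []
setAt []       (suc k) v = 0 ∷ setAt [] k v
setAt (a ∷ as) zero    v = v ∷ as
setAt (a ∷ as) (suc k) v = a ∷ setAt as k v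

eqExp : Exp → Exp → Bool
eqExp []       []       = true
eqExp []       (b ∷ bs) = (b ≡ᵇ 0) ∧ eqExp [] bs
eqExp (a ∷ as) []       = (a ≡ᵇ 0) ∧ eqExp as []
eqExp (a ∷ as) (b ∷ bs) = (a ≡ᵇ b) ∧ eqExp as bs

coeff : Poly → Exp → ℤ
coeff f e = foldr (λ t acc → if eqExp (proj₂ t) e then proj₁ t +ℤ acc else acc) (⁺ 0) f

support : Poly → List Exp
support f = map proj₂ (filter (λ t → Data.Bool._≟_ (isZero (coeff f (proj₂ t))) false) f)
  where
  isZero : ℤ → Bool
  isZero (⁺ zero) = true
  isZero _        = false

-- Divided difference ∂_i (0-based: variables x_{i+1}, x_{i+2}), i.e.
-- f ↦ (f - s_i f)/(x_{i+1} - x_{i+2}), written out on monomials: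
--   x^a y^b ↦  Σ_{k<a-b} x^{a-1-k} y^{b+k}      if a ≥ b
--   x^a y^b ↦ -Σ_{k<b-a} x^{a+k} y^{b-1-k}      if a < b
-- (x = x_{i+1}, y = x_{i+2}, other variables are constants), extended linearly.
∂mono : ℕ → ℤ × Exp → Poly
∂mono i (c , e) =
  if b <ᵇ suc a
  then map (λ k → c , setAt (setAt e i (a ∸ 1 ∸ k)) (suc i) (b Data.Nat.+ k)) (upTo (a ∸ b))
  else map (λ k → - c , setAt (setAt e i (a Data.Nat.+ k)) (suc i) (b ∸ 1 ∸ k)) (upTo (b ∸ a))
  where
  a = expAt e i
  b = expAt e (suc i)

∂ : ℕ → Poly → Poly
∂ i = concatMap (∂mono i)

-- 𝔖_{w_0} = x_1^{n-1} x_2^{n-2} ⋯ x_{n-1} for w_0 ∈ S_n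
topPoly : ℕ → Poly
topPoly n = (⁺ 1 , reverse (upTo n)) ∷ []

-- 𝔖_w = ∂_i 𝔖_{w s_i} at the first ascent i of w; w_0 is the only
-- permutation without ascents. Fuel n*n ≥ ℓ(w_0) suffices (each step
-- raises the length by one).
schubertList : ℕ → ℕ → List ℕ → Poly
schubertList n zero    w = topPoly n
schubertList n (suc k) w with firstAscent w
... | nothing = topPoly n
... | just i  = ∂ i (schubertList n k (swapAt i w))

schubert : ∀ {n} → Permutation′ n → Poly
schubert {n} w = schubertList n (n * n) (oneLine w)

-- Newton polytopes (convex hulls of exponent vectors), points with
-- rational coordinates indexed by ℕ (coordinate k ↔ x_{k+1}).

ℕtoℚ : ℕ → ℚ
ℕtoℚ k = ⁺ k / 1

sumℚ : List ℚ → ℚ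
sumℚ = foldr _+ℚ_ 0ℚ

_∈Conv_ : (ℕ → ℚ) → List Exp → Set
p ∈Conv S =
  Σ (List (ℚ × Exp)) λ comb →
      All (λ t → proj₂ t ∈ S) comb
    × All (λ t → 0ℚ ≤ℚ proj₁ t) comb
    × sumℚ (map proj₁ comb) ≡ 1ℚ
    × (∀ k → p k ≡ sumℚ (map (λ t → proj₁ t *ℚ ℕtoℚ (expAt (proj₂ t) k)) comb))

NewtonSub : Poly → Poly → Set
NewtonSub f g = ∀ p → p ∈Conv support f → p ∈Conv support g

_⪯D_ : ∀ {m n} → Permutation′ m → Permutation′ n → Set
u ⪯D v = NewtonSub (schubert u) (schubert v)

{-# OPTIONS --safe #-}

-- The cycle w with Lehmer code (0^K, ℓ, 0^ℓ) has Schubert polynomial h_ℓ(x_1, …, x_{K+1}),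
-- which contains every monomial of degree ℓ in K + 1 variables; for K large, w therefore
-- dominates every given u of length ℓ, since 𝔖_u is homogeneous of degree ℓ.
-- To compute 𝔖_w, note that on codes the step from w to w s_i at the first ascent i is
-- (c_i, c_{i+1}) ↦ (c_{i+1} + 1, c_i). All polynomials met between w and w_0 have the form
-- x^δ h_ℓ(x_1, …, x_{j+1}), and ∂_i acts with δ_i = δ_{i+1} + 1: it lowers δ_i by one and
-- adjoins a variable to h_ℓ exactly when i is the last index of h_ℓ.
module Submission where

open import Defs
open import Data.Bool using (Bool; true; false; T)
open import Data.Bool.Properties using (T-≡; ¬-not)
open import Data.Fin as Fin using (Fin; fromℕ; punchIn)
import Data.Fin.Properties as Finₚ
open import Data.Fin.Permutation using (Permutation′; _⟨$⟩ʳ_; lift₀; insert; insert-punchIn) renaming (id to idₚ)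
open import Data.Integer as ℤ using (ℤ; 0ℤ; 1ℤ)
import Data.Integer.Properties as ℤₚ
open import Algebra.Properties.CommutativeSemigroup ℤₚ.+-commutativeSemigroup using (interchange)
open import Data.List using (List; []; _∷_; _++_; length; filter; downFrom; map; upTo; applyUpTo; tabulate; allFin; replicate)
open import Data.List.Properties using (map-upTo; length-filter; filter-accept; filter-reject; filter-all; filter-none; reverse-upTo; length-downFrom; length-map; length-tabulate; map-tabulate; tabulate-cong)
open import Data.List.Membership.Propositional using (_∈_)
open import Data.List.Membership.Propositional.Properties using (∈-map⁺; ∈-map⁻; ∈-filter⁺; ∈-filter⁻)
open import Data.List.Relation.Binary.Permutation.Propositional using (_↭_; ↭-refl; ↭-sym; prep; swap; ↭⇒↭ₛ)
open import Data.List.Relation.Binary.Permutation.Propositional.Properties using (filter-↭; ↭-length)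
import Data.List.Relation.Binary.Permutation.Setoid.Properties as ↭ₛ
open import Data.List.Relation.Unary.All as All using (All; []; _∷_)
import Data.List.Relation.Unary.All.Properties as Allₚ
open import Data.List.Relation.Unary.AllPairs using (_∷_)
open import Data.List.Relation.Unary.Any using (here; there)
open import Data.List.Relation.Unary.Unique.Propositional using (Unique)
import Data.List.Relation.Unary.Unique.Propositional.Properties as Uniqueₚ
open import Data.Maybe using (just; nothing)
open import Data.Nat
open import Data.Nat.ListAction using (sum)
open import Data.Nat.Properties
open import Data.Nat.Tactic.RingSolver using (solve-∀)
open import Data.Product using (_×_; _,_; Σ; ∃; ∃₂; proj₁; proj₂)
open import Data.Rational as ℚ using (0ℚ)
open import Function using (_∘_; case_of_)
open import Function.Bundles using (module Equivalence; module Injection)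
open import Function.Properties.Inverse using (↔⇒↣)
open import Relation.Binary.PropositionalEquality
open import Relation.Nullary using (¬_; Dec; yes; no; contradiction)
open import Relation.Nullary.Decidable using (decidable-stable; ¬¬-excluded-middle)
open import Relation.Unary using (Decidable)

-- Polynomials are unnormalised sums whose terms may cancel, so `IsHook` prescribes every
-- coefficient (1 or 0) instead of a list of terms. No division is carried out: with x, y the
-- variables at positions `i` and `i + 1`, the coefficient of x^p y^q in ∂_i f is the sum over s ≤
-- min(p, q) of [x^(p+q+1-s) y^s] f - [x^s y^(p+q+1-s)] f. For the products met here, exchanging the
-- two exponents makes the difference vanish for every s except one, namely the exponent that δ
-- assigns to y, so the new coefficient is a single old one or 0. The relation between neighbouring
-- entries of δ must hold at every first ascent that is met; the inequalities in `HookCode` are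
-- chosen to force it, and to keep the first ascent away from the position of the largest letter.
-- Nothing needs to be known about the coefficients of 𝔖_u. Its support is drawn from its listed
-- terms, and each listed term, even one that cancels, has the right degree and the right variables.

infix 4 _≗ᵉ_

-- Lists that differ by trailing zeros denote the same monomial, so monomials are compared
-- entrywise; `eqExp` decides exactly this relation.
record _≗ᵉ_ (e g : Exp) : Set where
  constructor pointwise
  field
    at : ∀ t → expAt e t ≡ expAt g t
open _≗ᵉ_

≗ᵉ-sym : ∀ {e g} → e ≗ᵉ g → g ≗ᵉ e
≗ᵉ-sym e≗g = pointwise (sym ∘ at e≗g)

-- Changing exponents at one or two positions, and the degree

expAt-setAt : ∀ e i v → expAt (setAt e i v) i ≡ v
expAt-setAt []      zero    v = refl
expAt-setAt []      (suc i) v = expAt-setAt [] i v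
expAt-setAt (_ ∷ _) zero    v = refl
expAt-setAt (_ ∷ e) (suc i) v = expAt-setAt e i v

expAt-setAt-≢ : ∀ e i v t → t ≢ i → expAt (setAt e i v) t ≡ expAt e t
expAt-setAt-≢ e       zero    v zero    t≢i = contradiction refl t≢i
expAt-setAt-≢ []      zero    v (suc t) t≢i = refl
expAt-setAt-≢ (_ ∷ _) zero    v (suc t) t≢i = refl
expAt-setAt-≢ []      (suc i) v zero    t≢i = refl
expAt-setAt-≢ []      (suc i) v (suc t) t≢i = expAt-setAt-≢ [] i v t (t≢i ∘ cong suc)
expAt-setAt-≢ (_ ∷ _) (suc i) v zero    t≢i = refl
expAt-setAt-≢ (_ ∷ e) (suc i) v (suc t) t≢i = expAt-setAt-≢ e i v t (t≢i ∘ cong suc)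

sum-setAt : ∀ e i v → sum (setAt e i v) + expAt e i ≡ sum e + v
sum-setAt []      zero    v = trans (+-identityʳ (v + 0)) (+-identityʳ v)
sum-setAt []      (suc i) v = sum-setAt [] i v
sum-setAt (a ∷ e) zero    v = lemma v (sum e) a
  where
  lemma : ∀ v s a → v + s + a ≡ a + s + v
  lemma = solve-∀
sum-setAt (a ∷ e) (suc i) v = begin
  a + sum (setAt e i v) + expAt e i   ≡⟨ +-assoc a _ _ ⟩
  a + (sum (setAt e i v) + expAt e i) ≡⟨ cong (a +_) (sum-setAt e i v) ⟩
  a + (sum e + v)                     ≡⟨ +-assoc a _ v ⟨
  a + sum e + v                       ∎
  where open ≡-Reasoning

sum-cong : ∀ e g → e ≗ᵉ g → sum e ≡ sum g
sum-cong []      []      e≗g = refl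
sum-cong []      (b ∷ g) e≗g = cong₂ _+_ (at e≗g 0) (sum-cong [] g (pointwise (at e≗g ∘ suc)))
sum-cong (a ∷ e) []      e≗g = cong₂ _+_ (at e≗g 0) (sum-cong e [] (pointwise (at e≗g ∘ suc)))
sum-cong (a ∷ e) (b ∷ g) e≗g = cong₂ _+_ (at e≗g 0) (sum-cong e g (pointwise (at e≗g ∘ suc)))

eqExp-complete : ∀ e g → e ≗ᵉ g → eqExp e g ≡ true
eqExp-complete []      []      e≗g = refl
eqExp-complete []      (b ∷ g) e≗g rewrite sym (at e≗g 0) = eqExp-complete [] g (pointwise (at e≗g ∘ suc))
eqExp-complete (a ∷ e) []      e≗g rewrite at e≗g 0 = eqExp-complete e [] (pointwise (at e≗g ∘ suc))
eqExp-complete (a ∷ e) (b ∷ g) e≗g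
  rewrite at e≗g 0 | Equivalence.to T-≡ (≡⇒≡ᵇ b b refl) = eqExp-complete e g (pointwise (at e≗g ∘ suc))

eqExp-sound : ∀ e g → eqExp e g ≡ true → e ≗ᵉ g
eqExp-sound e g eq = pointwise (go e g eq)
  where
  go : ∀ e g → eqExp e g ≡ true → ∀ t → expAt e t ≡ expAt g t
  go []         []         eq t       = refl
  go []         (zero ∷ g) eq zero    = refl
  go []         (zero ∷ g) eq (suc t) = go [] g eq t
  go (zero ∷ e) []         eq zero    = refl
  go (zero ∷ e) []         eq (suc t) = go e [] eq t
  go (a ∷ e)    (b ∷ g)    eq t with a ≡ᵇ b in a≡b
  go (a ∷ e)    (b ∷ g)    eq zero    | true = ≡ᵇ⇒≡ a b (Equivalence.from T-≡ a≡b)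
  go (a ∷ e)    (b ∷ g)    eq (suc t) | true = go e g eq t

set₂ : Exp → ℕ → ℕ → ℕ → Exp
set₂ e i x y = setAt (setAt e i x) (suc i) y

i≢1+i : ∀ {i} → i ≢ suc i
i≢1+i ()

set₂-i : ∀ e i x y → expAt (set₂ e i x y) i ≡ x
set₂-i e i x y = trans (expAt-setAt-≢ (setAt e i x) (suc i) y i i≢1+i) (expAt-setAt e i x)

set₂-1+i : ∀ e i x y → expAt (set₂ e i x y) (suc i) ≡ y
set₂-1+i e i x y = expAt-setAt (setAt e i x) (suc i) y

set₂-≢ : ∀ e i x y t → t ≢ i → t ≢ suc i → expAt (set₂ e i x y) t ≡ expAt e t
set₂-≢ e i x y t t≢i t≢1+i =
  trans (expAt-setAt-≢ (setAt e i x) (suc i) y t t≢1+i) (expAt-setAt-≢ e i x t t≢i)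

sum-set₂ : ∀ e i x y →
  sum (set₂ e i x y) + (expAt e i + expAt e (suc i)) ≡ sum e + (x + y)
sum-set₂ e i x y = begin
  s₂ + (p + q)   ≡⟨ lemma s₂ p q ⟩
  s₂ + q + p     ≡⟨ cong (λ z → s₂ + z + p) (expAt-setAt-≢ e i x (suc i) (i≢1+i ∘ sym)) ⟨
  s₂ + q′ + p    ≡⟨ cong (_+ p) (sum-setAt (setAt e i x) (suc i) y) ⟩
  s₁ + y + p     ≡⟨ lemma′ s₁ y p ⟩
  s₁ + p + y     ≡⟨ cong (_+ y) (sum-setAt e i x) ⟩
  sum e + x + y  ≡⟨ +-assoc (sum e) x y ⟩
  sum e + (x + y) ∎
  where
  open ≡-Reasoning
  s₂ = sum (set₂ e i x y)
  s₁ = sum (setAt e i x)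
  p  = expAt e i
  q  = expAt e (suc i)
  q′ = expAt (setAt e i x) (suc i)
  lemma : ∀ a b c → a + (b + c) ≡ a + c + b
  lemma = solve-∀
  lemma′ : ∀ a b c → a + b + c ≡ a + c + b
  lemma′ = solve-∀

by-position : ∀ (i : ℕ) {P : ℕ → Set} → P i → P (suc i) →
  (∀ t → t ≢ i → t ≢ suc i → P t) → ∀ t → P t
by-position i Pi P1+i Pt t with t ≟ i | t ≟ suc i
... | yes refl | _        = Pi
... | no _     | yes refl = P1+i
... | no t≢i   | no t≢1+i = Pt t t≢i t≢1+i

AgreeOff : ℕ → Exp → Exp → Set
AgreeOff i e g = ∀ t → t ≢ i → t ≢ suc i → expAt e t ≡ expAt g t

set₂-≗ : ∀ {e i x y g} → AgreeOff i e g → x ≡ expAt g i → y ≡ expAt g (suc i) →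
  set₂ e i x y ≗ᵉ g
set₂-≗ {e} {i} {x} {y} off x≡ y≡ = pointwise (by-position i
  (trans (set₂-i e i x y) x≡)
  (trans (set₂-1+i e i x y) y≡)
  (λ t t≢i t≢1+i → trans (set₂-≢ e i x y t t≢i t≢1+i) (off t t≢i t≢1+i)))

≗-set₂ : ∀ {e i x y g} → set₂ e i x y ≗ᵉ g →
  AgreeOff i e g × x ≡ expAt g i × y ≡ expAt g (suc i)
≗-set₂ {e} {i} {x} {y} eq =
    (λ t t≢i t≢1+i → trans (sym (set₂-≢ e i x y t t≢i t≢1+i)) (at eq t))
  , trans (sym (set₂-i e i x y)) (at eq i)
  , trans (sym (set₂-1+i e i x y)) (at eq (suc i))

AgreeOff-sym : ∀ {i} e g → AgreeOff i e g → AgreeOff i g e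
AgreeOff-sym e g off t t≢i t≢1+i = sym (off t t≢i t≢1+i)

-- Indicator values and finite sums

Indicator : ℤ → Set → ℤ → Set
Indicator c P z = (P → z ≡ c) × (¬ P → z ≡ 0ℤ)

-- Integer equalities are stable, so excluded middle may be used to prove them.
by-cases : ∀ (P : Set) {x y : ℤ} → (Dec P → x ≡ y) → x ≡ y
by-cases P {x} {y} f = decidable-stable (x ℤ.≟ y) (λ x≢y → ¬¬-excluded-middle (x≢y ∘ f))

indicator-cong : ∀ {c P Q x y} → Indicator c P x → Indicator c Q y →
  (P → Q) → (Q → P) → x ≡ y
indicator-cong {P = P} (x₁ , x₀) (y₁ , y₀) P→Q Q→P = by-cases P λ where
  (yes p) → trans (x₁ p) (sym (y₁ (P→Q p)))
  (no ¬p) → trans (x₀ ¬p) (sym (y₀ (¬p ∘ Q→P)))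

indicator-neg : ∀ {c P x} → Indicator c P x → Indicator (ℤ.- c) P (ℤ.- x)
indicator-neg (x₁ , x₀) = cong ℤ.-_ ∘ x₁ , cong ℤ.-_ ∘ x₀

Σ< : ℕ → (ℕ → ℤ) → ℤ
Σ< zero    F = 0ℤ
Σ< (suc n) F = F 0 ℤ.+ Σ< n (F ∘ suc)

Σ<-cong : ∀ n {F G} → (∀ s → s < n → F s ≡ G s) → Σ< n F ≡ Σ< n G
Σ<-cong zero    F≡G = refl
Σ<-cong (suc n) F≡G = cong₂ ℤ._+_ (F≡G 0 z<s) (Σ<-cong n (λ s s<n → F≡G (suc s) (s<s s<n)))

Σ<-+ : ∀ n F G → Σ< n (λ s → F s ℤ.+ G s) ≡ Σ< n F ℤ.+ Σ< n G
Σ<-+ zero    F G = refl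
Σ<-+ (suc n) F G = trans (cong (ℤ._+_ (F 0 ℤ.+ G 0)) (Σ<-+ n (F ∘ suc) (G ∘ suc)))
  (interchange (F 0) (G 0) _ _)

Σ<-0 : ∀ n → Σ< n (λ _ → 0ℤ) ≡ 0ℤ
Σ<-0 zero    = refl
Σ<-0 (suc n) = trans (ℤₚ.+-identityˡ _) (Σ<-0 n)

-- Serves for the difference of two sums that cancel term by term except at one index `d`: what is
-- left is `F d`.
Σ<-single : ∀ n d {F G} → d < n → (∀ s → s < n → s ≢ d → F s ≡ G s) → G d ≡ 0ℤ →
  Σ< n F ≡ F d ℤ.+ Σ< n G
Σ<-single (suc n) zero {F} {G} _ F≡G Gd≡0 = cong (ℤ._+_ (F 0)) (begin
  Σ< n (F ∘ suc)         ≡⟨ Σ<-cong n (λ s s<n → F≡G (suc s) (s<s s<n) λ ()) ⟩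
  Σ< n (G ∘ suc)         ≡⟨ ℤₚ.+-identityˡ _ ⟨
  0ℤ ℤ.+ Σ< n (G ∘ suc)  ≡⟨ cong (ℤ._+ Σ< n (G ∘ suc)) Gd≡0 ⟨
  G 0 ℤ.+ Σ< n (G ∘ suc) ∎)
  where open ≡-Reasoning
Σ<-single (suc n) (suc d) {F} {G} (s<s d<n) F≡G Gd≡0 = begin
  F 0 ℤ.+ Σ< n (F ∘ suc)                     ≡⟨ cong₂ ℤ._+_ (F≡G 0 z<s λ ())
      (Σ<-single n d d<n (λ s s<n s≢d → F≡G (suc s) (s<s s<n) (s≢d ∘ suc-injective)) Gd≡0) ⟩
  G 0 ℤ.+ (F (suc d) ℤ.+ Σ< n (G ∘ suc))     ≡⟨ ℤₚ.+-assoc (G 0) _ _ ⟨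
  G 0 ℤ.+ F (suc d) ℤ.+ Σ< n (G ∘ suc)       ≡⟨ cong (ℤ._+ Σ< n (G ∘ suc)) (ℤₚ.+-comm (G 0) _) ⟩
  F (suc d) ℤ.+ G 0 ℤ.+ Σ< n (G ∘ suc)       ≡⟨ ℤₚ.+-assoc (F (suc d)) _ _ ⟩
  F (suc d) ℤ.+ (G 0 ℤ.+ Σ< n (G ∘ suc))     ∎
  where open ≡-Reasoning

-- Uniqueness allows at most one nonzero summand, so nothing is counted twice and the sum is again
-- an indicator.
Σ<-indicator : ∀ n {c F} {P : ℕ → Set} → (∀ s → Indicator c (P s) (F s)) →
  (∀ {s s′} → P s → P s′ → s ≡ s′) → Indicator c (∃ λ s → s < n × P s) (Σ< n F)
Σ<-indicator zero    ind uniq = (λ ()) , λ _ → refl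
Σ<-indicator (suc n) {c} {F} {P} ind uniq = present , absent
  where
  tail : Indicator c (∃ λ s → s < n × P (suc s)) (Σ< n (F ∘ suc))
  tail = Σ<-indicator n (ind ∘ suc) (λ p p′ → suc-injective (uniq p p′))
  present : (∃ λ s → s < suc n × P s) → Σ< (suc n) F ≡ c
  present (zero , _ , p) = trans
    (cong₂ ℤ._+_ (proj₁ (ind 0) p)
      (proj₂ tail λ (_ , _ , p′) → case uniq p p′ of λ ()))
    (ℤₚ.+-identityʳ c)
  present (suc s , s<s s<n , p) = trans
    (cong₂ ℤ._+_ (proj₂ (ind 0) λ p′ → case uniq p p′ of λ ())
      (proj₁ tail (s , s<n , p)))
    (ℤₚ.+-identityˡ c)
  absent : ¬ (∃ λ s → s < suc n × P s) → Σ< (suc n) F ≡ 0ℤ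
  absent ¬p = cong₂ ℤ._+_ (proj₂ (ind 0) λ p → ¬p (0 , z<s , p))
    (proj₂ tail λ (s , s<n , p) → ¬p (suc s , s<s s<n , p))

-- Coefficients of formal sums and of divided differences

coeff-∷ : ∀ t f g → coeff (t ∷ f) g ≡ coeff (t ∷ []) g ℤ.+ coeff f g
coeff-∷ (c , e) f g with eqExp e g
... | true  = cong (ℤ._+ coeff f g) (sym (ℤₚ.+-identityʳ c))
... | false = sym (ℤₚ.+-identityˡ _)

coeff-++ : ∀ f h g → coeff (f ++ h) g ≡ coeff f g ℤ.+ coeff h g
coeff-++ []      h g = sym (ℤₚ.+-identityˡ _)
coeff-++ (t ∷ f) h g = begin
  coeff (t ∷ (f ++ h)) g                                 ≡⟨ coeff-∷ t (f ++ h) g ⟩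
  coeff (t ∷ []) g ℤ.+ coeff (f ++ h) g                ≡⟨ cong (ℤ._+_ (coeff (t ∷ []) g)) (coeff-++ f h g) ⟩
  coeff (t ∷ []) g ℤ.+ (coeff f g ℤ.+ coeff h g)       ≡⟨ ℤₚ.+-assoc (coeff (t ∷ []) g) _ _ ⟨
  coeff (t ∷ []) g ℤ.+ coeff f g ℤ.+ coeff h g         ≡⟨ cong (ℤ._+ coeff h g) (coeff-∷ t f g) ⟨
  coeff (t ∷ f) g ℤ.+ coeff h g                          ∎
  where open ≡-Reasoning

coeff-term : ∀ c e g → Indicator c (e ≗ᵉ g) (coeff ((c , e) ∷ []) g)
coeff-term c e g with eqExp e g in eq
... | true  = (λ _ → ℤₚ.+-identityʳ c) , (λ e≇g → contradiction (eqExp-sound e g eq) e≇g)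
... | false = (λ e≗g → case trans (sym eq) (eqExp-complete e g e≗g) of λ ()) , λ _ → refl

coeff-map-upTo : ∀ n (t : ℕ → ℤ × Exp) g →
  coeff (map t (upTo n)) g ≡ Σ< n (λ k → coeff (t k ∷ []) g)
coeff-map-upTo n t g = trans (cong (λ f → coeff f g) (map-upTo t n)) (go n t)
  where
  go : ∀ n t → coeff (applyUpTo t n) g ≡ Σ< n (λ k → coeff (t k ∷ []) g)
  go zero    t = refl
  go (suc n) t = trans (coeff-∷ (t 0) (applyUpTo (t ∘ suc) n) g) (cong (ℤ._+_ (coeff (t 0 ∷ []) g)) (go n (t ∘ suc)))

-- x^p y^q occurs in (x^a y^b - x^b y^a)/(x - y), where a ≥ b.
Occurs : (a b p q : ℕ) → Set
Occurs a b p q = b ≤ p × b ≤ q × a + b ≡ suc (p + q)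

occurs-swap : ∀ {a b p q} → Occurs a b p q → Occurs a b q p
occurs-swap {p = p} {q} (b≤p , b≤q , eq) = b≤q , b≤p , trans eq (cong suc (+-comm p q))

occurs⇒< : ∀ {a b p q} → Occurs a b p q → b < a
occurs⇒< {a} {b} {p} {q} (b≤p , b≤q , eq) =
  +-cancelʳ-≤ b (suc b) a (≤-trans (s≤s (+-mono-≤ b≤p b≤q)) (≤-reflexive (sym eq)))

quotient-exponent⇒occurs : ∀ {a b p q k} → k < a ∸ b → a ∸ 1 ∸ k ≡ p → b + k ≡ q → Occurs a b p q
quotient-exponent⇒occurs {a} {b} {k = k} k<a∸b refl refl
  with r , eq ← m≤n⇒∃[o]m+o≡n k<a∸b
  -- Since `k < a ∸ b`, the truncated difference is nonzero, so `b < a` and `a` really is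
  -- `suc k + r + b`.
  with refl ← trans (cong (_+ b) eq) (m∸n+n≡m {a} {b} (<⇒≤ (m∸n≢0⇒n<m {a} {b} λ a∸b≡0 → case subst (k <_) a∸b≡0 k<a∸b of λ ())))
  = subst (b ≤_) (sym p≡) (m≤n+m b r) , m≤m+n b k
  , trans (lemma k r b) (cong (λ p → suc (p + (b + k))) (sym p≡))
  where
  p≡ : k + r + b ∸ k ≡ r + b
  p≡ = trans (cong (_∸ k) (+-assoc k r b)) (m+n∸m≡n k (r + b))
  lemma : ∀ k r b → suc (k + r + b) + b ≡ suc (r + b + (b + k))
  lemma = solve-∀

regroup : ∀ b r k → suc (b + r + (b + k)) ≡ suc (b + r + k) + b
regroup = solve-∀

occurs⇒quotient-exponent : ∀ {a b p q} → Occurs a b p q →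
  ∃ λ k → k < a ∸ b × a ∸ 1 ∸ k ≡ p × b + k ≡ q
occurs⇒quotient-exponent {a} {b} (b≤p , b≤q , eq)
  with r , refl ← m≤n⇒∃[o]m+o≡n b≤p
  with k , refl ← m≤n⇒∃[o]m+o≡n b≤q
  with refl ← +-cancelʳ-≡ b a (suc (b + r + k)) (trans eq (regroup b r k))
  = k
  , ≤-trans (s≤s (m≤n+m k r)) (≤-reflexive (sym (trans (cong (λ z → suc z ∸ b) (+-assoc b r k))
      (trans (cong (_∸ b) (sym (+-suc b (r + k)))) (m+n∸m≡n b (suc (r + k)))))))
  , m+n∸n≡m (b + r) k , refl

-- The same relation seen from the quotient: once `p` and `q` are fixed, a dividend is determined by
-- its smaller exponent `s ≤ p ⊓ q`, the larger one being the complement to `p + q + 1`.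
coefficient-index⇒occurs : ∀ {p q s} → s < suc (p ⊓ q) → Occurs (suc (p + q) ∸ s) s p q
coefficient-index⇒occurs {p} {q} {s} (s≤s s≤m) = s≤p , ≤-trans s≤m (m⊓n≤n p q)
  , m∸n+n≡m (≤-trans s≤p (≤-trans (m≤m+n p q) (n≤1+n _)))
  where
  s≤p = ≤-trans s≤m (m⊓n≤m p q)

occurs⇒coefficient-index : ∀ {a b p q} → Occurs a b p q → b < suc (p ⊓ q) × a ≡ suc (p + q) ∸ b
occurs⇒coefficient-index {a} {b} (b≤p , b≤q , eq) =
  s≤s (⊓-glb b≤p b≤q) , trans (sym (m+n∸n≡m a b)) (cong (_∸ b) eq)

module _ (i : ℕ) (g : Exp) where
  private
    p = expAt g i
    q = expAt g (suc i)
    N = suc (p ⊓ q)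

  -- The monomials whose divided difference contains `g`: those of `upper` contribute with sign
  -- plus, those of `lower` with sign minus.
  upper lower : ℕ → Exp
  upper s = set₂ g i (suc (p + q) ∸ s) s
  lower s = set₂ g i s (suc (p + q) ∸ s)

  Σupper Σlower : Poly → ℤ
  Σupper f = Σ< N (coeff f ∘ upper)
  Σlower f = Σ< N (coeff f ∘ lower)

  private
    Hit : Exp → Set
    Hit e = AgreeOff i e g × Occurs (expAt e i) (expAt e (suc i)) p q

    CoHit : Exp → Set
    CoHit e = AgreeOff i e g × Occurs (expAt e (suc i)) (expAt e i) p q

    upper⇒hit : ∀ {e} → (∃ λ s → s < N × e ≗ᵉ upper s) → Hit e
    upper⇒hit {e} (s , s<N , eq) with off , a≡ , refl ← ≗-set₂ {g} {i} (≗ᵉ-sym eq) =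
      AgreeOff-sym g e off , subst (λ a → Occurs a s p q) a≡ (coefficient-index⇒occurs s<N)

    hit⇒upper : ∀ {e} → Hit e → ∃ λ s → s < N × e ≗ᵉ upper s
    hit⇒upper {e} (off , occ) with s<N , a≡ ← occurs⇒coefficient-index occ =
      _ , s<N , ≗ᵉ-sym (set₂-≗ {g} {i} (AgreeOff-sym e g off) (sym a≡) refl)

    lower⇒cohit : ∀ {e} → (∃ λ s → s < N × e ≗ᵉ lower s) → CoHit e
    lower⇒cohit {e} (s , s<N , eq) with off , refl , a≡ ← ≗-set₂ {g} {i} (≗ᵉ-sym eq) =
      AgreeOff-sym g e off , subst (λ a → Occurs a s p q) a≡ (coefficient-index⇒occurs s<N)

    cohit⇒lower : ∀ {e} → CoHit e → ∃ λ s → s < N × e ≗ᵉ lower s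
    cohit⇒lower {e} (off , occ) with s<N , a≡ ← occurs⇒coefficient-index occ =
      _ , s<N , ≗ᵉ-sym (set₂-≗ {g} {i} (AgreeOff-sym e g off) refl (sym a≡))

    Σupper-term : ∀ c e → Indicator c (∃ λ s → s < N × e ≗ᵉ upper s) (Σupper ((c , e) ∷ []))
    Σupper-term c e = Σ<-indicator N (λ s → coeff-term c e (upper s))
      λ {s} {s′} eq eq′ → trans (proj₂ (proj₂ (≗-set₂ {g} {i} (≗ᵉ-sym eq))))
        (sym (proj₂ (proj₂ (≗-set₂ {g} {i} (≗ᵉ-sym eq′)))))

    Σlower-term : ∀ c e → Indicator c (∃ λ s → s < N × e ≗ᵉ lower s) (Σlower ((c , e) ∷ []))
    Σlower-term c e = Σ<-indicator N (λ s → coeff-term c e (lower s))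
      λ {s} {s′} eq eq′ → trans (proj₁ (proj₂ (≗-set₂ {g} {i} (≗ᵉ-sym eq))))
        (sym (proj₁ (proj₂ (≗-set₂ {g} {i} (≗ᵉ-sym eq′)))))

  -- The quotient of one term contains `g` at most once, and `e` equals at most one candidate
  -- dividend of `g`. Both sums are therefore indicators, of equivalent conditions. The sum of the
  -- opposite orientation vanishes because `Occurs` forces a strict inequality between the two
  -- exponents of `e`.
  coeff-∂mono : ∀ c e →
    coeff (∂mono i (c , e)) g ≡ Σupper ((c , e) ∷ []) ℤ.- Σlower ((c , e) ∷ [])
  coeff-∂mono c e with expAt e (suc i) <ᵇ suc (expAt e i) in b≤a
  ... | true = begin
    coeff (map t (upTo n)) g                               ≡⟨ coeff-map-upTo n t g ⟩
    Σ< n (λ k → coeff (t k ∷ []) g)                        ≡⟨ indicator-cong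
        (Σ<-indicator n (λ k → coeff-term c (proj₂ (t k)) g)
          λ {k} {k′} eq eq′ → +-cancelˡ-≡ b k k′ (trans (proj₂ (proj₂ (≗-set₂ {e} {i} eq)))
             (sym (proj₂ (proj₂ (≗-set₂ {e} {i} eq′))))))
        (Σupper-term c e)
        (λ (k , k<n , eq) → let off , p≡ , q≡ = ≗-set₂ {e} {i} eq in
           hit⇒upper (off , quotient-exponent⇒occurs k<n p≡ q≡))
        (λ hit → let off , occ = upper⇒hit hit
                     k , k<n , p≡ , q≡ = occurs⇒quotient-exponent occ in
           k , k<n , set₂-≗ {e} {i} off p≡ q≡) ⟩
    Σupper ((c , e) ∷ [])                                  ≡⟨ ℤₚ.+-identityʳ _ ⟨
    Σupper ((c , e) ∷ []) ℤ.- 0ℤ                           ≡⟨ cong (λ z → Σupper ((c , e) ∷ []) ℤ.- z)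
        (proj₂ (Σlower-term c e) λ hit →
           <⇒≱ (occurs⇒< (proj₂ (lower⇒cohit hit)))
               (s≤s⁻¹ (<ᵇ⇒< b (suc a) (Equivalence.from T-≡ b≤a)))) ⟨
    Σupper ((c , e) ∷ []) ℤ.- Σlower ((c , e) ∷ [])        ∎
    where
    open ≡-Reasoning
    a = expAt e i
    b = expAt e (suc i)
    n = a ∸ b
    t : ℕ → ℤ × Exp
    t k = c , set₂ e i (a ∸ 1 ∸ k) (b + k)
  ... | false = begin
    coeff (map t (upTo n)) g                               ≡⟨ coeff-map-upTo n t g ⟩
    Σ< n (λ k → coeff (t k ∷ []) g)                        ≡⟨ indicator-cong
        (Σ<-indicator n (λ k → coeff-term (ℤ.- c) (proj₂ (t k)) g)
          λ {k} {k′} eq eq′ → +-cancelˡ-≡ a k k′ (trans (proj₁ (proj₂ (≗-set₂ {e} {i} eq)))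
             (sym (proj₁ (proj₂ (≗-set₂ {e} {i} eq′))))))
        (indicator-neg (Σlower-term c e))
        (λ (k , k<n , eq) → let off , p≡ , q≡ = ≗-set₂ {e} {i} eq in
           cohit⇒lower (off , occurs-swap (quotient-exponent⇒occurs k<n q≡ p≡)))
        (λ hit → let off , occ = lower⇒cohit hit
                     k , k<n , q≡ , p≡ = occurs⇒quotient-exponent (occurs-swap occ) in
           k , k<n , set₂-≗ {e} {i} off p≡ q≡) ⟩
    ℤ.- Σlower ((c , e) ∷ [])                              ≡⟨ ℤₚ.+-identityˡ _ ⟨
    0ℤ ℤ.- Σlower ((c , e) ∷ [])                           ≡⟨ cong (ℤ._- Σlower ((c , e) ∷ []))
        (proj₂ (Σupper-term c e) λ hit →
           subst T b≤a (<⇒<ᵇ (m≤n⇒m≤1+n (occurs⇒< (proj₂ (upper⇒hit hit)))))) ⟨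
    Σupper ((c , e) ∷ []) ℤ.- Σlower ((c , e) ∷ [])        ∎
    where
    open ≡-Reasoning
    a = expAt e i
    b = expAt e (suc i)
    n = b ∸ a
    t : ℕ → ℤ × Exp
    t k = ℤ.- c , set₂ e i (a + k) (b ∸ 1 ∸ k)

  -- Follows by linearity from single terms. Only coefficients of `f` enter on the right, so
  -- cancellations among its terms do no harm.
  coeff-∂ : ∀ f → coeff (∂ i f) g ≡ Σupper f ℤ.- Σlower f
  coeff-∂ [] = sym (cong₂ ℤ._-_ (Σ<-0 N) (Σ<-0 N))
  coeff-∂ (t@(c , e) ∷ f) = begin
    coeff (∂mono i t ++ ∂ i f) g                ≡⟨ coeff-++ (∂mono i t) (∂ i f) g ⟩
    coeff (∂mono i t) g ℤ.+ coeff (∂ i f) g     ≡⟨ cong₂ ℤ._+_ (coeff-∂mono c e) (coeff-∂ f) ⟩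
    (U₁ ℤ.- L₁) ℤ.+ (U₂ ℤ.- L₂)                 ≡⟨ interchange U₁ (ℤ.- L₁) U₂ (ℤ.- L₂) ⟩
    (U₁ ℤ.+ U₂) ℤ.+ (ℤ.- L₁ ℤ.+ ℤ.- L₂)         ≡⟨ cong (ℤ._+_ (U₁ ℤ.+ U₂)) (ℤₚ.neg-distrib-+ L₁ L₂) ⟨
    (U₁ ℤ.+ U₂) ℤ.- (L₁ ℤ.+ L₂)                 ≡⟨ cong₂ ℤ._-_ (split upper) (split lower) ⟨
    Σupper (t ∷ f) ℤ.- Σlower (t ∷ f)           ∎
    where
    open ≡-Reasoning
    U₁ = Σupper (t ∷ [])
    U₂ = Σupper f
    L₁ = Σlower (t ∷ [])
    L₂ = Σlower f
    split : ∀ h → Σ< N (coeff (t ∷ f) ∘ h) ≡ Σ< N (coeff (t ∷ []) ∘ h) ℤ.+ Σ< N (coeff f ∘ h)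
    split h = trans (Σ<-cong N (λ s _ → coeff-∷ t f (h s)))
      (Σ<-+ N (coeff (t ∷ []) ∘ h) (coeff f ∘ h))

-- Divided differences of a monomial times a complete homogeneous polynomial

Fits : Bool → ℕ → ℕ → Set
Fits true  d x = d ≤ x
Fits false d x = x ≡ d

fits⇒≤ : ∀ β {d x} → Fits β d x → d ≤ x
fits⇒≤ true  d≤x  = d≤x
fits⇒≤ false refl = ≤-refl

¬fits-1+ : ∀ β {d} → ¬ Fits β (suc d) d
¬fits-1+ true  = 1+n≰n
¬fits-1+ false = i≢1+i

-- The symmetry behind the cancellation. `β` and `β₁` tell whether x_i and x_(i+1) are variables of
-- `h`. If both are, the constraints are lower bounds and `b ≢ d` makes up for the one unit by which
-- they differ. If x_(i+1) is not, its exponent is exactly `d`, which is the excluded case.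
fits-transpose : ∀ β β₁ {d a b} → (β₁ ≡ true → β ≡ true) → b ≢ d → b < a →
  Fits β (suc d) a × Fits β₁ d b → Fits β (suc d) b × Fits β₁ d a
fits-transpose true  true  _ b≢d b<a (d<a , d≤b) = ≤∧≢⇒< d≤b (b≢d ∘ sym) , <⇒≤ d<a
fits-transpose _     false _ b≢d b<a (_ , b≡d)   = contradiction b≡d b≢d
fits-transpose false true  β₁≤β with () ← β₁≤β refl

fits-untranspose : ∀ β β₁ {d a b} → (β₁ ≡ true → β ≡ true) → b < a →
  Fits β (suc d) b × Fits β₁ d a → Fits β (suc d) a × Fits β₁ d b
fits-untranspose true  true  _ b<a (d<b , d≤a) = <-trans d<b b<a , <⇒≤ d<b
fits-untranspose β     false _ b<a (fit , refl) = contradiction (fits⇒≤ β fit) (<⇒≯ b<a)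
fits-untranspose false true  β₁≤β with () ← β₁≤β refl

-- Concerns the one dividend x_i^a x_(i+1)^d that survives. If x_i is not a variable of `h`, then
-- `a = d + 1`, so `p + q = 2d` and both exponents are squeezed to `d`.
fits-quotient : ∀ β {d a p q} → a + d ≡ suc (p + q) → d ≤ p → d ≤ q →
  Fits β (suc d) a → Fits β d p × Fits β d q
fits-quotient true  eq d≤p d≤q _    = d≤p , d≤q
fits-quotient false {d} {p = p} {q} eq d≤p d≤q refl =
    ≤-antisym (+-cancelʳ-≤ d p d (≤-trans (+-monoʳ-≤ p d≤q) (≤-reflexive (sym eq′)))) d≤p
  , ≤-antisym (+-cancelˡ-≤ d q d (≤-trans (+-monoˡ-≤ q d≤p) (≤-reflexive (sym eq′)))) d≤q
  where eq′ = suc-injective eq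

fits-dividend : ∀ β β₁ {d a p q} → a + d ≡ suc (p + q) →
  Fits β d p × Fits β d q → Fits β (suc d) a × Fits β₁ d d
fits-dividend β β₁ {d} {a} {p} {q} eq (fp , fq) = fit β fp fq , fit-refl β₁
  where
  fit-refl : ∀ β → Fits β d d
  fit-refl true  = ≤-refl
  fit-refl false = refl
  fit : ∀ β → Fits β d p → Fits β d q → Fits β (suc d) a
  fit true  d≤p d≤q = +-cancelʳ-≤ d (suc d) a (≤-trans (s≤s (+-mono-≤ d≤p d≤q)) (≤-reflexive (sym eq)))
  fit false refl refl = +-cancelʳ-≡ d a (suc d) eq

-- The exponent vectors of degree D occurring in x^δ · h(x_t : fr t), h complete homogeneous.
HookTerm : (ℕ → Bool) → (ℕ → ℕ) → ℕ → Exp → Set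
HookTerm fr δ D g = (∀ t → Fits (fr t) (δ t) (expAt g t)) × sum g ≡ D

IsHook : (ℕ → Bool) → (ℕ → ℕ) → ℕ → Poly → Set
IsHook fr δ D f = ∀ g → Indicator 1ℤ (HookTerm fr δ D g) (coeff f g)

-- Put `d = δ′ (suc i)`. For `s ≢ d` the coefficients at `upper s` and `lower s` agree by the
-- exchange of exponents, and the one at `lower d` is 0 because x_i needs exponent at least `d + 1`.
-- What remains is the coefficient at `upper d`. The hypothesis on `fr′` leaves three cases, treated
-- together: x_i and x_(i+1) both in `h`, only x_i in `h` (then x_(i+1) is adjoined), or neither.
∂-hook : ∀ {fr fr′ δ δ′ D f} i →
  (fr′ (suc i) ≡ true → fr′ i ≡ true) → δ′ i ≡ suc (δ′ (suc i)) →
  fr (suc i) ≡ fr′ i → (∀ t → t ≢ suc i → fr t ≡ fr′ t) →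
  δ i ≡ δ′ (suc i) → (∀ t → t ≢ i → δ t ≡ δ′ t) →
  IsHook fr′ δ′ (suc D) f → IsHook fr δ D (∂ i f)
∂-hook {fr} {fr′} {δ} {δ′} {D} {f} i fr′≤ δ′i fr1+i fr≢ δi δ≢ hook g = answer
  where
  p = expAt g i
  q = expAt g (suc i)
  d = δ′ (suc i)
  β = fr′ i
  β₁ = fr′ (suc i)
  N = suc (p ⊓ q)
  U L : ℕ → ℤ
  U = coeff f ∘ upper i g
  L = coeff f ∘ lower i g

  complement : ∀ s → s < N → suc (p + q) ∸ s + s ≡ suc (p + q)
  complement s s<N = proj₂ (proj₂ (coefficient-index⇒occurs s<N))

  lower<upper : ∀ s → s < N → s < suc (p + q) ∸ s
  lower<upper s s<N = occurs⇒< (coefficient-index⇒occurs s<N)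

  Rest : Set
  Rest = ∀ t → t ≢ i → t ≢ suc i → Fits (fr′ t) (δ′ t) (expAt g t)

  degree : ∀ x y → x + y ≡ suc (p + q) → sum (set₂ g i x y) ≡ suc (sum g)
  degree x y eq = +-cancelʳ-≡ (p + q) _ _ (begin
    sum (set₂ g i x y) + (p + q) ≡⟨ sum-set₂ g i x y ⟩
    sum g + (x + y)              ≡⟨ cong (sum g +_) eq ⟩
    sum g + suc (p + q)          ≡⟨ +-suc (sum g) (p + q) ⟩
    suc (sum g) + (p + q)        ∎)
    where open ≡-Reasoning

  term⇒ : ∀ x y → x + y ≡ suc (p + q) → HookTerm fr′ δ′ (suc D) (set₂ g i x y) →
    Rest × (Fits β (suc d) x × Fits β₁ d y) × sum g ≡ D
  term⇒ x y eq (fits , sum≡) =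
      (λ t t≢i t≢1+i → subst (Fits (fr′ t) (δ′ t)) (set₂-≢ g i x y t t≢i t≢1+i) (fits t))
    , (subst₂ (Fits β) δ′i (set₂-i g i x y) (fits i)
    , subst (Fits β₁ d) (set₂-1+i g i x y) (fits (suc i)))
    , suc-injective (trans (sym (degree x y eq)) sum≡)

  ⇒term : ∀ x y → x + y ≡ suc (p + q) →
    Rest × (Fits β (suc d) x × Fits β₁ d y) × sum g ≡ D → HookTerm fr′ δ′ (suc D) (set₂ g i x y)
  ⇒term x y eq (rest , (fx , fy) , sum≡) = by-position i
      (subst₂ (Fits β) (sym δ′i) (sym (set₂-i g i x y)) fx)
      (subst (Fits β₁ d) (sym (set₂-1+i g i x y)) fy)
      (λ t t≢i t≢1+i → subst (Fits (fr′ t) (δ′ t)) (sym (set₂-≢ g i x y t t≢i t≢1+i)) (rest t t≢i t≢1+i))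
    , trans (degree x y eq) (cong suc sum≡)

  U≡L : ∀ s → s < N → s ≢ d → U s ≡ L s
  U≡L s s<N s≢d = indicator-cong (hook (upper i g s)) (hook (lower i g s))
    (λ term → let rest , fits , sum≡ = term⇒ _ s eq term in
       ⇒term s _ eq′ (rest , fits-transpose β β₁ fr′≤ s≢d (lower<upper s s<N) fits , sum≡))
    (λ term → let rest , fits , sum≡ = term⇒ s _ eq′ term in
       ⇒term _ s eq (rest , fits-untranspose β β₁ fr′≤ (lower<upper s s<N) fits , sum≡))
    where
    eq = complement s s<N
    eq′ = trans (+-comm s _) eq

  Ld≡0 : d < N → L d ≡ 0ℤ
  Ld≡0 d<N = proj₂ (hook (lower i g d)) λ term →
    ¬fits-1+ β (proj₁ (proj₁ (proj₂ (term⇒ d _ (trans (+-comm d _) (complement d d<N)) term))))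

  target⇒ : HookTerm fr δ D g → Rest × (Fits β d p × Fits β d q) × sum g ≡ D
  target⇒ (fits , sum≡) =
      (λ t t≢i t≢1+i → subst₂ (λ b x → Fits b x (expAt g t)) (fr≢ t t≢1+i) (δ≢ t t≢i) (fits t))
    , ( subst₂ (λ b x → Fits b x p) (fr≢ i i≢1+i) δi (fits i)
      , subst₂ (λ b x → Fits b x q) fr1+i (δ≢ (suc i) (i≢1+i ∘ sym)) (fits (suc i)))
    , sum≡

  ⇒target : Rest × (Fits β d p × Fits β d q) × sum g ≡ D → HookTerm fr δ D g
  ⇒target (rest , (fp , fq) , sum≡) = by-position i
      (subst₂ (λ b x → Fits b x p) (sym (fr≢ i i≢1+i)) (sym δi) fp)
      (subst₂ (λ b x → Fits b x q) (sym fr1+i) (sym (δ≢ (suc i) (i≢1+i ∘ sym))) fq)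
      (λ t t≢i t≢1+i → subst₂ (λ b x → Fits b x (expAt g t))
         (sym (fr≢ t t≢1+i)) (sym (δ≢ t t≢i)) (rest t t≢i t≢1+i))
    , sum≡

  cancel : ∀ u l → (u ℤ.+ l) ℤ.- l ≡ u
  cancel u l = trans (ℤₚ.+-assoc u l (ℤ.- l))
    (trans (cong (ℤ._+_ u) (ℤₚ.+-inverseʳ l)) (ℤₚ.+-identityʳ u))

  answer : Indicator 1ℤ (HookTerm fr δ D g) (coeff (∂ i f) g)
  answer with d <? N
  ... | yes d<N =
      (λ target → let rest , (fp , fq) , sum≡ = target⇒ target in
         trans collapse (proj₁ (hook (upper i g d))
           (⇒term _ d eq (rest , fits-dividend β β₁ eq (fp , fq) , sum≡))))
    , (λ ¬target → trans collapse (proj₂ (hook (upper i g d)) λ term →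
         let rest , (fx , _) , sum≡ = term⇒ _ d eq term in
         ¬target (⇒target (rest , fits-quotient β eq d≤p d≤q fx , sum≡))))
    where
    eq = complement d d<N
    d≤p = proj₁ (coefficient-index⇒occurs d<N)
    d≤q = proj₁ (proj₂ (coefficient-index⇒occurs d<N))
    collapse : coeff (∂ i f) g ≡ U d
    collapse = trans (coeff-∂ i g f)
      (trans (cong (ℤ._- Σ< N L) (Σ<-single N d d<N U≡L (Ld≡0 d<N))) (cancel (U d) (Σ< N L)))
  -- Here `d` exceeds `p ⊓ q`: no index equals `d`, so every pair cancels, and `g` is not a term
  -- because it would need `d ≤ p` and `d ≤ q`.
  ... | no d≮N =
      (λ target → let _ , (fp , fq) , _ = target⇒ target in
         contradiction (s≤s (⊓-glb (fits⇒≤ β fp) (fits⇒≤ β fq))) d≮N)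
    , (λ _ → trans (coeff-∂ i g f)
        (trans (cong (ℤ._- Σ< N L) (Σ<-cong N λ s s<N → U≡L s s<N λ { refl → d≮N s<N }))
          (ℤₚ.+-inverseʳ (Σ< N L))))

-- Lehmer codes and first ascents

below : ℕ → List ℕ → ℕ
below x xs = length (filter (λ y → y <? x) xs)

code : List ℕ → Exp
code []       = []
code (x ∷ xs) = below x xs ∷ code xs

inversions-code : ∀ w → inversions w ≡ sum (code w)
inversions-code []      = refl
inversions-code (x ∷ w) = cong (below x w +_) (inversions-code w)

below-< : ∀ {x y} xs → y < x → below x (y ∷ xs) ≡ suc (below x xs)
below-< xs y<x = cong length (filter-accept (_<? _) y<x)

below-≮ : ∀ {x y} xs → ¬ y < x → below x (y ∷ xs) ≡ below x xs
below-≮ xs y≮x = cong length (filter-reject (_<? _) y≮x)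

below-mono : ∀ {x y} xs → x ≤ y → below x xs ≤ below y xs
below-mono []       x≤y = z≤n
below-mono {x} {y} (z ∷ xs) x≤y = go (z <? x) (z <? y)
  where
  ih = below-mono xs x≤y
  go : Dec (z < x) → Dec (z < y) → below x (z ∷ xs) ≤ below y (z ∷ xs)
  go (yes z<x) _         = subst₂ _≤_ (sym (below-< xs z<x)) (sym (below-< xs (<-≤-trans z<x x≤y))) (s≤s ih)
  go (no z≮x)  (yes z<y) = subst₂ _≤_ (sym (below-≮ xs z≮x)) (sym (below-< xs z<y)) (m≤n⇒m≤1+n ih)
  go (no z≮x)  (no z≮y)  = subst₂ _≤_ (sym (below-≮ xs z≮x)) (sym (below-≮ xs z≮y)) ih

swapAt-↭ : ∀ i w → swapAt i w ↭ w
swapAt-↭ zero    []          = ↭-refl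
swapAt-↭ zero    (x ∷ [])    = ↭-refl
swapAt-↭ zero    (x ∷ y ∷ w) = swap y x ↭-refl
swapAt-↭ (suc i) []          = ↭-refl
swapAt-↭ (suc i) (x ∷ w)     = prep x (swapAt-↭ i w)

Unique-swapAt : ∀ i {w} → Unique w → Unique (swapAt i w)
Unique-swapAt i {w} = ↭ₛ.Unique-resp-↭ (setoid ℕ) (↭⇒↭ₛ (↭-sym (swapAt-↭ i w)))

below-swapAt : ∀ x i w → below x (swapAt i w) ≡ below x w
below-swapAt x i w = ↭-length (filter-↭ (λ y → y <? x) (swapAt-↭ i w))

transposed : Exp → ℕ → Exp
transposed c i = set₂ c i (suc (expAt c (suc i))) (expAt c i)

-- An ascent of a permutation gives `c_t ≤ c_(t+1)` and a descent gives `c_(t+1) < c_t`, so the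
-- position of the first ascent can be read off the code and the permutation forgotten.
record FirstAscent (c : Exp) (i : ℕ) : Set where
  field
    ascends : expAt c i ≤ expAt c (suc i)
    first   : ∀ t → t < i → expAt c (suc t) < expAt c t
open FirstAscent

firstAscent-nothing : ∀ w → Unique w → firstAscent w ≡ nothing → code w ≡ downFrom (length w)
firstAscent-nothing []          _ _ = refl
firstAscent-nothing (x ∷ [])    _ _ = refl
firstAscent-nothing (x ∷ y ∷ w) ((x≢y ∷ _) ∷ uniq) eq
  with x <ᵇ y in x<ᵇy | firstAscent (y ∷ w) in eq′
firstAscent-nothing (x ∷ y ∷ w) ((x≢y ∷ _) ∷ uniq) eq | false | nothing
  = cong₂ _∷_ (≤-antisym (length-filter (_<? x) (y ∷ w)) length≤) ih
  where
  ih = firstAscent-nothing (y ∷ w) uniq eq′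
  y<x : y < x
  y<x = ≤∧≢⇒< (≮⇒≥ λ x<y → subst T x<ᵇy (<⇒<ᵇ x<y)) (x≢y ∘ sym)
  length≤ : suc (length w) ≤ below x (y ∷ w)
  length≤ = begin
    suc (length w)    ≡⟨ cong (λ c → suc (expAt c 0)) ih ⟨
    suc (below y w)   ≤⟨ s≤s (below-mono w (<⇒≤ y<x)) ⟩
    suc (below x w)   ≡⟨ below-< w y<x ⟨
    below x (y ∷ w)   ∎
    where open ≤-Reasoning

-- Exchanging an ascent `x < y` puts `x` behind `y`: the count of `y` grows by one, while that of
-- `x` stays, as `y` was never below `x`. Earlier counts see only a permuted tail.
firstAscent-just : ∀ w i → Unique w → firstAscent w ≡ just i →
  suc i < length w × FirstAscent (code w) i × code (swapAt i w) ≡ transposed (code w) i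
firstAscent-just (x ∷ y ∷ w) i ((x≢y ∷ _) ∷ uniq) eq
  with x <ᵇ y in x<ᵇy | firstAscent (y ∷ w) in eq′
firstAscent-just (x ∷ y ∷ w) i ((x≢y ∷ _) ∷ uniq) refl | true | _ =
    s<s z<s
  , record
      { ascends = ≤-trans (≤-reflexive below-x) (below-mono w (<⇒≤ x<y))
      ; first   = λ _ ()
      }
  , cong₂ (λ a b → a ∷ b ∷ code w) (below-< w x<y) (sym below-x)
  where
  x<y : x < y
  x<y = <ᵇ⇒< x y (Equivalence.from T-≡ x<ᵇy)
  below-x : below x (y ∷ w) ≡ below x w
  below-x = below-≮ w (<⇒≯ x<y)
firstAscent-just (x ∷ y ∷ w) i ((x≢y ∷ _) ∷ uniq) refl | false | just j
  with 1+j<n , asc , swapped ← firstAscent-just (y ∷ w) j uniq eq′ =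
    s<s 1+j<n
  , record
      { ascends = ascends asc
      ; first   = λ where
          zero    _         → <-≤-trans (s≤s (below-mono w (<⇒≤ y<x))) (≤-reflexive (sym (below-< w y<x)))
          (suc t) (s<s t<j) → first asc t t<j
      }
  , cong₂ _∷_ (below-swapAt x j (y ∷ w)) swapped
  where
  y<x : y < x
  y<x = ≤∧≢⇒< (≮⇒≥ λ x<y → subst T x<ᵇy (<⇒<ᵇ x<y)) (x≢y ∘ sym)

code-bounded : ∀ w t → t < length w → expAt (code w) t + t < length w
code-bounded (x ∷ w) zero    _         = s≤s (≤-trans (≤-reflexive (+-identityʳ _)) (length-filter (_<? x) w))
code-bounded (x ∷ w) (suc t) (s<s t<n) = ≤-trans (s≤s (≤-reflexive (+-suc _ t))) (s≤s (code-bounded w t t<n))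

sum-code≤ : ∀ w → sum (code w) ≤ sum (downFrom (length w))
sum-code≤ []      = z≤n
sum-code≤ (x ∷ w) = +-mono-≤ (length-filter (_<? x) w) (sum-code≤ w)

sum-transposed : ∀ c i → sum (transposed c i) ≡ suc (sum c)
sum-transposed c i = +-cancelʳ-≡ (a + b) _ _ (begin
  sum (transposed c i) + (a + b) ≡⟨ sum-set₂ c i (suc b) a ⟩
  sum c + suc (b + a)            ≡⟨ cong (λ s → sum c + suc s) (+-comm b a) ⟩
  sum c + suc (a + b)            ≡⟨ +-suc (sum c) (a + b) ⟩
  suc (sum c) + (a + b)          ∎)
  where
  open ≡-Reasoning
  a = expAt c i
  b = expAt c (suc i)

module _ {n : ℕ} (P : Exp → Poly → Set)
  (top  : P (downFrom n) ((1ℤ , downFrom n) ∷ []))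
  (step : ∀ {c i f} → suc i < n → FirstAscent c i → (∀ t → t < n → expAt c t + t < n) →
    P (transposed c i) f → P c (∂ i f))
  where

  -- Induction along the recursion, phrased on codes. The code sum grows by one with each exchange
  -- and never exceeds that of the longest permutation, so under the bound on `k` the fuel cannot
  -- run out while an ascent is left.
  schubertList-elim : ∀ k w → Unique w → length w ≡ n → sum (downFrom n) ≤ k + sum (code w) →
    P (code w) (schubertList n k w)
  schubertList-elim k w uniq refl fuel with firstAscent w in eq
  schubertList-elim zero    w uniq refl fuel | nothing =
    subst₂ P (sym (firstAscent-nothing w uniq eq)) (cong (λ e → (1ℤ , e) ∷ []) (sym (reverse-upTo n))) top
  schubertList-elim (suc k) w uniq refl fuel | nothing rewrite eq =
    subst₂ P (sym (firstAscent-nothing w uniq eq)) (cong (λ e → (1ℤ , e) ∷ []) (sym (reverse-upTo n))) top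
  schubertList-elim zero    w uniq refl fuel | just i
    with _ , _ , swapped ← firstAscent-just w i uniq eq =
    contradiction (begin-strict
      sum (code w)                          <⟨ n<1+n _ ⟩
      suc (sum (code w))                    ≡⟨ sum-transposed (code w) i ⟨
      sum (transposed (code w) i)           ≡⟨ cong sum swapped ⟨
      sum (code (swapAt i w))               ≤⟨ sum-code≤ (swapAt i w) ⟩
      sum (downFrom (length (swapAt i w)))  ≡⟨ cong (sum ∘ downFrom) (↭-length (swapAt-↭ i w)) ⟩
      sum (downFrom n)                      ∎) (≤⇒≯ fuel)
    where open ≤-Reasoning
  schubertList-elim (suc k) w uniq refl fuel | just i rewrite eq
    with 1+i<n , asc , swapped ← firstAscent-just w i uniq eq =
    step 1+i<n asc (code-bounded w) (subst (λ c → P c (schubertList n k (swapAt i w))) swapped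
      (schubertList-elim k (swapAt i w) (Unique-swapAt i uniq) (↭-length (swapAt-↭ i w)) (begin
        sum (downFrom n)             ≤⟨ fuel ⟩
        suc k + sum (code w)         ≡⟨ +-suc k _ ⟨
        k + suc (sum (code w))       ≡⟨ cong (k +_) (sum-transposed (code w) i) ⟨
        k + sum (transposed (code w) i) ≡⟨ cong (λ c → k + sum c) swapped ⟨
        k + sum (code (swapAt i w))  ∎)))
    where open ≤-Reasoning

-- Degree and variables of the terms of a Schubert polynomial

∂mono-exponents : ∀ i c e → All
  (λ t → ∃₂ λ x y → proj₂ t ≡ set₂ e i x y × expAt e i + expAt e (suc i) ≡ suc (x + y))
  (∂mono i (c , e))
∂mono-exponents i c e with expAt e (suc i) <ᵇ suc (expAt e i)
... | true  = Allₚ.map⁺ (All.map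
  (λ k<n → _ , _ , refl , proj₂ (proj₂ (quotient-exponent⇒occurs k<n refl refl)))
  (Allₚ.all-upTo (expAt e i ∸ expAt e (suc i))))
... | false = Allₚ.map⁺ (All.map
  (λ {k} k<n → _ , _ , refl , trans (+-comm (expAt e i) _)
     (proj₂ (proj₂ (occurs-swap {expAt e (suc i)} {expAt e i} (quotient-exponent⇒occurs {k = k} k<n refl refl)))))
  (Allₚ.all-upTo (expAt e (suc i) ∸ expAt e i)))

-- Imposed on every listed term, cancelling or not; this passes through `∂` term by term and still
-- covers the support.
HomogeneousIn : ℕ → ℕ → Poly → Set
HomogeneousIn n D = All λ t → sum (proj₂ t) ≡ D × (∀ k → n ≤ k → expAt (proj₂ t) k ≡ 0)

∂-homogeneous : ∀ {n i D f} → suc i < n → HomogeneousIn n (suc D) f → HomogeneousIn n D (∂ i f)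
∂-homogeneous {n} {i} {D} {f} 1+i<n hom =
  Allₚ.concat⁺ (Allₚ.map⁺ (All.map (λ {t} → on-term (proj₁ t) (proj₂ t)) hom))
  where
  on-term : ∀ c e → sum e ≡ suc D × (∀ k → n ≤ k → expAt e k ≡ 0) →
    HomogeneousIn n D (∂mono i (c , e))
  on-term c e (sum≡ , zeros) = All.map
    (λ { {_ , _} (x , y , refl , eq) → degree x y eq , λ k n≤k →
       trans (set₂-≢ e i x y k (>⇒≢ (<-≤-trans (<-trans (n<1+n i) 1+i<n) n≤k)) (>⇒≢ (<-≤-trans 1+i<n n≤k)))
         (zeros k n≤k) })
    (∂mono-exponents i c e)
    where
    degree : ∀ x y → expAt e i + expAt e (suc i) ≡ suc (x + y) → sum (set₂ e i x y) ≡ D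
    degree x y eq = suc-injective (+-cancelʳ-≡ (x + y) _ _ (begin
      suc (sum (set₂ e i x y)) + (x + y) ≡⟨ +-suc _ (x + y) ⟨
      sum (set₂ e i x y) + suc (x + y)   ≡⟨ cong (sum (set₂ e i x y) +_) eq ⟨
      sum (set₂ e i x y) + (expAt e i + expAt e (suc i)) ≡⟨ sum-set₂ e i x y ⟩
      sum e + (x + y)                    ≡⟨ cong (_+ (x + y)) sum≡ ⟩
      suc D + (x + y)                    ∎))
      where open ≡-Reasoning

expAt-≥length : ∀ e k → length e ≤ k → expAt e k ≡ 0
expAt-≥length []      k       _         = refl
expAt-≥length (_ ∷ e) (suc k) (s≤s l≤k) = expAt-≥length e k l≤k

sum-downFrom≤ : ∀ n → sum (downFrom n) ≤ n * n
sum-downFrom≤ zero    = z≤n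
sum-downFrom≤ (suc n) = +-mono-≤ (n≤1+n n) (≤-trans (sum-downFrom≤ n) (*-monoʳ-≤ n (n≤1+n n)))

oneLine-tabulate : ∀ {n} (w : Permutation′ n) → oneLine w ≡ tabulate (λ i → Fin.toℕ (w ⟨$⟩ʳ i))
oneLine-tabulate w = map-tabulate (λ i → i) (λ i → Fin.toℕ (w ⟨$⟩ʳ i))

length-oneLine : ∀ {n} (w : Permutation′ n) → length (oneLine w) ≡ n
length-oneLine {n} w = trans (length-map _ (allFin n)) (length-tabulate (λ i → i))

Unique-oneLine : ∀ {n} (w : Permutation′ n) → Unique (oneLine w)
Unique-oneLine {n} w =
  Uniqueₚ.map⁺ (Injection.injective (↔⇒↣ w) ∘ Finₚ.toℕ-injective) (Uniqueₚ.allFin⁺ n)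

schubert-elim : ∀ {n} (P : Exp → Poly → Set) →
  P (downFrom n) ((1ℤ , downFrom n) ∷ []) →
  (∀ {c i f} → suc i < n → FirstAscent c i → (∀ t → t < n → expAt c t + t < n) →
    P (transposed c i) f → P c (∂ i f)) →
  (w : Permutation′ n) → P (code (oneLine w)) (schubert w)
schubert-elim {n} P top step w = schubertList-elim P top step (n * n) (oneLine w)
  (Unique-oneLine w) (length-oneLine w) (≤-trans (sum-downFrom≤ n) (m≤m+n (n * n) _))

schubert-homogeneous : ∀ {n} (w : Permutation′ n) → HomogeneousIn n (len w) (schubert w)
schubert-homogeneous {n} w = subst (λ D → HomogeneousIn n D (schubert w)) (sym (inversions-code (oneLine w)))
  (schubert-elim (λ c f → HomogeneousIn n (sum c) f)
    ((refl , λ k n≤k → expAt-≥length (downFrom n) k (≤-trans (≤-reflexive (length-downFrom n)) n≤k)) ∷ [])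
    (λ {c} {i} {f} 1+i<n _ _ ih →
      ∂-homogeneous {n} {i} {sum c} {f} 1+i<n (subst (λ D → HomogeneousIn n D f) (sum-transposed c i) ih))
    w)

-- The codes between the cycle and the longest permutation

≤ᵇ-true : ∀ {m n} → m ≤ n → (m ≤ᵇ n) ≡ true
≤ᵇ-true m≤n = Equivalence.to T-≡ (≤⇒≤ᵇ m≤n)

≤ᵇ-false : ∀ {m n} → n < m → (m ≤ᵇ n) ≡ false
≤ᵇ-false {m} {n} n<m = ¬-not λ eq → <⇒≱ n<m (≤ᵇ⇒≤ m n (Equivalence.from T-≡ eq))

≤ᵇ-cong : ∀ {m n m′ n′} → (m ≤ n → m′ ≤ n′) → (m′ ≤ n′ → m ≤ n) → (m ≤ᵇ n) ≡ (m′ ≤ᵇ n′)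
≤ᵇ-cong {m} {n} {m′} {n′} f g with m ≤? n
... | yes m≤n = trans (≤ᵇ-true m≤n) (sym (≤ᵇ-true (f m≤n)))
... | no m≰n  = trans (≤ᵇ-false (≰⇒> m≰n)) (sym (≤ᵇ-false (≰⇒> (m≰n ∘ g))))

update : (ℕ → ℕ) → ℕ → ℕ → ℕ → ℕ
update δ i v t with t ≟ i
... | yes _ = v
... | no  _ = δ t

update-same : ∀ δ i v → update δ i v i ≡ v
update-same δ i v with i ≟ i
... | yes _  = refl
... | no i≢i = contradiction refl i≢i

update-≢ : ∀ δ i v {t} → t ≢ i → update δ i v t ≡ δ t
update-≢ δ i v {t} t≢i with t ≟ i
... | yes t≡i = contradiction t≡i t≢i
... | no _    = refl

-- The codes met on the way from the cycle with code (0^K, ℓ, 0^ℓ) to the longest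
-- permutation: j is the position of the largest letter, and δ is the code after making
-- that letter smaller than the next ℓ largest ones, all of which stay behind it.
record HookCode (K ℓ : ℕ) (c : Exp) (δ : ℕ → ℕ) (j : ℕ) : Set where
  field
    δ-max  : δ j + j ≡ K
    before : ∀ t → t < j → δ t + t < K
    decr   : ∀ t → 0 < t + j → δ (suc t) ≤ δ t
    c-max  : expAt c j ≡ δ j + ℓ
    c-rest : ∀ t → t ≢ j → expAt c t ≡ δ t
open HookCode

module _ {K ℓ : ℕ} where
  private
    n = suc (K + ℓ)

  -- `before` and `δ-max` compare `δ j + j` with `δ (suc j) + suc j`. Together with `decr` this
  -- yields equality of the two entries, as `∂-hook` requires when the largest letter moves.
  δ-before-max : ∀ {c δ j} → HookCode K ℓ c δ (suc j) → δ j ≤ δ (suc j)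
  δ-before-max {δ = δ} {j} H = +-cancelʳ-≤ (suc j) _ _
    (≤-trans (≤-reflexive (+-suc (δ j) j)) (≤-trans (before H j (n<1+n j)) (≤-reflexive (sym (δ-max H)))))

  ascent-before-max : ∀ {c δ j} → HookCode K ℓ c δ (suc j) → expAt c j ≤ expAt c (suc j)
  ascent-before-max {c} {δ} {j} H = begin
    expAt c j       ≡⟨ c-rest H j i≢1+i ⟩
    δ j             ≤⟨ δ-before-max H ⟩
    δ (suc j)       ≤⟨ m≤m+n _ ℓ ⟩
    δ (suc j) + ℓ   ≡⟨ c-max H ⟨
    expAt c (suc j) ∎
    where open ≤-Reasoning

  -- At the largest letter `expAt c j + j` is `K + ℓ`, so an ascent there would push
  -- `expAt c (suc j) + suc j` up to `n`, beyond the bound for codes.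
  first-ascent-not-max : ∀ {c δ j i} → HookCode K ℓ c δ j → FirstAscent c i → suc i < n →
    (∀ t → t < n → expAt c t + t < n) → i ≢ j
  first-ascent-not-max {c} {δ} {i = i} H asc 1+i<n bounded refl = <-irrefl refl (begin-strict
    n                            ≡⟨ cong (λ k → suc (k + ℓ)) (δ-max H) ⟨
    suc (δ i + i + ℓ)            ≡⟨ lemma (δ i) i ℓ ⟩
    δ i + ℓ + suc i              ≡⟨ cong (_+ suc i) (c-max H) ⟨
    expAt c i + suc i            ≤⟨ +-monoˡ-≤ (suc i) (ascends asc) ⟩
    expAt c (suc i) + suc i      <⟨ bounded (suc i) 1+i<n ⟩
    n                            ∎)
    where
    open ≤-Reasoning
    lemma : ∀ a b c → suc (a + b + c) ≡ a + c + suc b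
    lemma = solve-∀

  -- The position just before the largest letter is always an ascent, so the first ascent can lie
  -- behind that letter only when it stands in front.
  ascent-after-max : ∀ {c δ j i} → HookCode K ℓ c δ j → FirstAscent c i → j < i → j ≡ 0
  ascent-after-max {j = zero}  H asc j<i = refl
  ascent-after-max {j = suc j} H asc j<i =
    contradiction (ascent-before-max H) (<⇒≱ (first asc j (<-trans (n<1+n j) j<i)))

  -- The largest letter stays put, so `c` and `δ` agree at `i` and `suc i`. The ascent and `decr`
  -- bound the two entries against each other, hence they are equal and the exchange only raises
  -- entry `i` by one. Since `i ≢ j`, both positions lie on the same side of the last variable of
  -- `h`, whose variables do not change.
  ∂-hookCode-rest : ∀ {c δ j i f} → HookCode K ℓ c δ j → FirstAscent c i →
    i ≢ j → suc i ≢ j → (j < i → j ≡ 0) →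
    (∀ δ′ j′ → HookCode K ℓ (transposed c i) δ′ j′ → IsHook (_≤ᵇ j′) δ′ (suc (sum c)) f) →
    IsHook (_≤ᵇ j) δ (sum c) (∂ i f)
  ∂-hookCode-rest {c} {δ} {j} {i} {f} H asc i≢j 1+i≢j j<i⇒j≡0 ih =
    ∂-hook {δ = δ} {f = f} i
      (λ eq → ≤ᵇ-true (≤-trans (n≤1+n i) (≤ᵇ⇒≤ (suc i) j (Equivalence.from T-≡ eq))))
      (trans δ′i (cong suc (sym δ′1+i)))
      (≤ᵇ-cong (≤-trans (n≤1+n i)) (λ i≤j → ≤∧≢⇒< i≤j i≢j))
      (λ _ _ → refl)
      (trans δi≡ (sym δ′1+i))
      (λ t t≢i → sym (update-≢ δ i _ t≢i))
      (ih δ′ j H′)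
    where
    d = δ (suc i)
    δ′ = update δ i (suc d)
    δ′i : δ′ i ≡ suc d
    δ′i = update-same δ i _
    δ′1+i : δ′ (suc i) ≡ d
    δ′1+i = update-≢ δ i _ (i≢1+i ∘ sym)
    δ′≢ : ∀ {t} → t ≢ i → δ′ t ≡ δ t
    δ′≢ = update-≢ δ i _
    ci≡ : expAt c i ≡ δ i
    ci≡ = c-rest H i i≢j
    c1+i≡ : expAt c (suc i) ≡ d
    c1+i≡ = c-rest H (suc i) 1+i≢j
    0<i+j : 0 < i + j
    0<i+j = n≢0⇒n>0 λ i+j≡0 → i≢j (trans (m+n≡0⇒m≡0 i i+j≡0) (sym (m+n≡0⇒n≡0 i i+j≡0)))
    δi≡ : δ i ≡ d
    δi≡ = ≤-antisym (subst₂ _≤_ ci≡ c1+i≡ (ascends asc)) (decr H i 0<i+j)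
    before′ : ∀ t → t < j → δ′ t + t < K
    before′ t t<j = case (t ≟ i) of λ where
      -- Here `suc i < j`, and `δ′ i + i` equals `δ (suc i) + suc i`, which `before` already bounds.
      (yes refl) → subst (λ x → x + t < K) (sym δ′i)
        (subst (_< K) (+-suc d t) (before H (suc t) (≤∧≢⇒< t<j 1+i≢j)))
      (no t≢i)   → subst (λ x → x + t < K) (sym (δ′≢ t≢i)) (before H t t<j)
    decr′ : ∀ t → 0 < t + j → δ′ (suc t) ≤ δ′ t
    decr′ t 0<t+j = case (t ≟ i) of λ where
      (yes refl) → subst₂ _≤_ (sym δ′1+i) (sym δ′i) (n≤1+n d)
      (no t≢i)   → subst (δ′ (suc t) ≤_) (sym (δ′≢ t≢i)) (case (suc t ≟ i) of λ where
        -- The raised entry is `expAt c i + 1`; it does not exceed its left neighbour because the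
        -- code descends strictly before the first ascent. If `t` were `j`, then `j = 0 = t`, which
        -- `0 < t + j` rules out.
        (yes refl)  → let t≢j = λ t≡j → <⇒≢ 0<t+j (sym (cong₂ _+_
                                (trans t≡j (j<i⇒j≡0 (s≤s (≤-reflexive (sym t≡j)))))
                                (j<i⇒j≡0 (s≤s (≤-reflexive (sym t≡j)))))) in
          subst₂ _≤_ (sym (trans δ′i (cong suc (trans (sym δi≡) (sym ci≡))))) (c-rest H t t≢j) (first asc t (n<1+n t))
        (no 1+t≢i) → subst (_≤ δ t) (sym (δ′≢ 1+t≢i)) (decr H t 0<t+j))
    c-rest′ : ∀ t → t ≢ j → expAt (transposed c i) t ≡ δ′ t
    c-rest′ = by-position i
      (λ _ → trans (set₂-i c i _ _) (trans (cong suc c1+i≡) (sym δ′i)))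
      (λ _ → trans (set₂-1+i c i _ _) (trans ci≡ (trans δi≡ (sym δ′1+i))))
      (λ t t≢i t≢1+i t≢j → trans (set₂-≢ c i _ _ t t≢i t≢1+i) (trans (c-rest H t t≢j) (sym (δ′≢ t≢i))))
    H′ : HookCode K ℓ (transposed c i) δ′ j
    H′ = record
      { δ-max  = trans (cong (_+ j) (δ′≢ (i≢j ∘ sym))) (δ-max H)
      ; before = before′
      ; decr   = decr′
      ; c-max  = trans (set₂-≢ c i _ _ j (i≢j ∘ sym) (1+i≢j ∘ sym))
                   (trans (c-max H) (cong (_+ ℓ) (sym (δ′≢ (i≢j ∘ sym)))))
      ; c-rest = c-rest′
      }

  -- The largest letter moves from `suc i` to `i` and takes its surplus `ℓ` along, so `δ` changes as
  -- in any other exchange. In the polynomial the last variable of `h` moves from position `i` to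
  -- `suc i` under `∂ i`.
  ∂-hookCode-max : ∀ {c δ i f} → HookCode K ℓ c δ (suc i) → FirstAscent c i →
    (∀ δ′ j′ → HookCode K ℓ (transposed c i) δ′ j′ → IsHook (_≤ᵇ j′) δ′ (suc (sum c)) f) →
    IsHook (_≤ᵇ suc i) δ (sum c) (∂ i f)
  ∂-hookCode-max {c} {δ} {i} {f} H asc ih =
    ∂-hook {δ = δ} {f = f} i
      (λ _ → ≤ᵇ-true {i} ≤-refl)
      (trans δ′i (cong suc (sym δ′1+i)))
      (trans (≤ᵇ-true {suc i} ≤-refl) (sym (≤ᵇ-true {i} ≤-refl)))
      (λ t t≢1+i → ≤ᵇ-cong (λ t≤1+i → s≤s⁻¹ (≤∧≢⇒< t≤1+i t≢1+i)) m≤n⇒m≤1+n)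
      (trans δi≡ (sym δ′1+i))
      (λ t t≢i → sym (update-≢ δ i _ t≢i))
      (ih δ′ i H′)
    where
    d = δ (suc i)
    δ′ = update δ i (suc d)
    δ′i : δ′ i ≡ suc d
    δ′i = update-same δ i _
    δ′1+i : δ′ (suc i) ≡ d
    δ′1+i = update-≢ δ i _ (i≢1+i ∘ sym)
    δ′≢ : ∀ {t} → t ≢ i → δ′ t ≡ δ t
    δ′≢ = update-≢ δ i _
    ci≡ : expAt c i ≡ δ i
    ci≡ = c-rest H i i≢1+i
    0<t+1+i : ∀ t → 0 < t + suc i
    0<t+1+i t = subst (0 <_) (sym (+-suc t i)) z<s
    δi≡ : δ i ≡ d
    δi≡ = ≤-antisym (δ-before-max H) (decr H i (0<t+1+i i))
    decr′ : ∀ t → δ′ (suc t) ≤ δ′ t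
    decr′ t = case (t ≟ i) of λ where
      (yes refl) → subst₂ _≤_ (sym δ′1+i) (sym δ′i) (n≤1+n d)
      (no t≢i)   → subst (δ′ (suc t) ≤_) (sym (δ′≢ t≢i)) (case (suc t ≟ i) of λ where
        (yes refl)  → subst₂ _≤_ (sym (trans δ′i (cong suc (trans (sym δi≡) (sym ci≡)))))
          (c-rest H t (<⇒≢ (m≤n⇒m≤1+n (n<1+n t)))) (first asc t (n<1+n t))
        (no 1+t≢i) → subst (_≤ δ t) (sym (δ′≢ 1+t≢i)) (decr H t (0<t+1+i t)))
    c-rest′ : ∀ t → t ≢ i → expAt (transposed c i) t ≡ δ′ t
    c-rest′ = by-position i
      (λ i≢i → contradiction refl i≢i)
      (λ _ → trans (set₂-1+i c i _ _) (trans ci≡ (trans δi≡ (sym δ′1+i))))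
      (λ t t≢i t≢1+i _ → trans (set₂-≢ c i _ _ t t≢i t≢1+i) (trans (c-rest H t t≢1+i) (sym (δ′≢ t≢i))))
    H′ : HookCode K ℓ (transposed c i) δ′ i
    H′ = record
      { δ-max  = trans (cong (_+ i) δ′i) (trans (sym (+-suc d i)) (δ-max H))
      ; before = λ t t<i → subst (λ x → x + t < K) (sym (δ′≢ (<⇒≢ t<i))) (before H t (m≤n⇒m≤1+n t<i))
      ; decr   = λ t _ → decr′ t
      ; c-max  = trans (set₂-i c i _ _) (trans (cong suc (c-max H)) (cong (_+ ℓ) (sym δ′i)))
      ; c-rest = c-rest′
      }

  ∂-hookCode : ∀ {c δ j i f} → suc i < n → FirstAscent c i →
    (∀ t → t < n → expAt c t + t < n) → HookCode K ℓ c δ j →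
    (∀ δ′ j′ → HookCode K ℓ (transposed c i) δ′ j′ → IsHook (_≤ᵇ j′) δ′ (suc (sum c)) f) →
    IsHook (_≤ᵇ j) δ (sum c) (∂ i f)
  ∂-hookCode {j = j} {i} {f} 1+i<n asc bounded H ih with suc i ≟ j
  ... | yes refl  = ∂-hookCode-max {f = f} H asc ih
  ... | no 1+i≢j = ∂-hookCode-rest {f = f} H asc (first-ascent-not-max H asc 1+i<n bounded) 1+i≢j
                     (ascent-after-max H asc) ih

  downFrom-decreasing : ∀ n t → suc t < n → expAt (downFrom n) (suc t) < expAt (downFrom n) t
  downFrom-decreasing (suc (suc n)) zero    _           = ≤-refl
  downFrom-decreasing (suc n)       (suc t) (s<s 1+t<n) = downFrom-decreasing n t 1+t<n

  -- The longest permutation has no ascent, whereas the place before the largest letter would be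
  -- one; hence `j = 0`. Then `h` has a single variable: all later exponents are prescribed, and the
  -- degree determines the first.
  top-hook : ∀ δ j → HookCode K ℓ (downFrom n) δ j →
    IsHook (_≤ᵇ j) δ (sum (downFrom n)) ((1ℤ , downFrom n) ∷ [])
  top-hook δ (suc j) H g = contradiction (ascent-before-max H)
    (<⇒≱ (downFrom-decreasing n j (s≤s (≤-trans (m≤n+m (suc j) (δ (suc j)))
      (≤-trans (≤-reflexive (δ-max H)) (m≤m+n K ℓ))))))
  top-hook δ zero H g = present , absent
    where
    c = downFrom n
    term = coeff-term 1ℤ c g
    hook⇒≗ : HookTerm (_≤ᵇ 0) δ (sum c) g → c ≗ᵉ g
    hook⇒≗ (fits , sum≡) = pointwise λ where
        zero    → +-cancelˡ-≡ (sum c) _ _ (begin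
          sum c + expAt c 0                        ≡⟨ cong (_+ expAt c 0) sum≡ ⟨
          sum g + expAt c 0                        ≡⟨ cong (_+ expAt c 0) (sum-cong g (setAt c 0 (expAt g 0)) (pointwise off)) ⟩
          sum (setAt c 0 (expAt g 0)) + expAt c 0  ≡⟨ sum-setAt c 0 (expAt g 0) ⟩
          sum c + expAt g 0                        ∎)
        (suc t) → rest t
      where
      open ≡-Reasoning
      rest : ∀ t → expAt c (suc t) ≡ expAt g (suc t)
      rest t = trans (c-rest H (suc t) λ ()) (sym (fits (suc t)))
      off : ∀ t → expAt g t ≡ expAt (setAt c 0 (expAt g 0)) t
      off zero    = sym (expAt-setAt c 0 (expAt g 0))
      off (suc t) = trans (sym (rest t)) (sym (expAt-setAt-≢ c 0 (expAt g 0) (suc t) λ ()))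
    ≗⇒hook : c ≗ᵉ g → HookTerm (_≤ᵇ 0) δ (sum c) g
    ≗⇒hook c≗g =
        (λ where
          zero    → ≤-trans (m≤m+n (δ 0) ℓ) (≤-reflexive (trans (sym (c-max H)) (at c≗g 0)))
          (suc t) → trans (sym (at c≗g (suc t))) (c-rest H (suc t) λ ()))
      , sum-cong g c (≗ᵉ-sym c≗g)
    present : HookTerm (_≤ᵇ 0) δ (sum c) g → coeff ((1ℤ , c) ∷ []) g ≡ 1ℤ
    present = proj₁ term ∘ hook⇒≗
    absent : ¬ HookTerm (_≤ᵇ 0) δ (sum c) g → coeff ((1ℤ , c) ∷ []) g ≡ 0ℤ
    absent ¬h = proj₂ term (¬h ∘ ≗⇒hook)

  -- The invariant quantifies over `δ` and `j` because each step calls the induction hypothesis with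
  -- new ones.
  schubert-hook : (w : Permutation′ n) → ∀ δ j → HookCode K ℓ (code (oneLine w)) δ j →
    IsHook (_≤ᵇ j) δ (sum (code (oneLine w))) (schubert w)
  schubert-hook = schubert-elim
    (λ c f → ∀ δ j → HookCode K ℓ c δ j → IsHook (_≤ᵇ j) δ (sum c) f)
    top-hook
    (λ {c} {i} {f} 1+i<n asc bounded ih δ j H → ∂-hookCode {f = f} 1+i<n asc bounded H
      λ δ′ j′ H′ → subst (λ D → IsHook (_≤ᵇ j′) δ′ D f) (sum-transposed c i) (ih δ′ j′ H′))

-- The cycle and its code

cycle : ∀ K ℓ → Permutation′ (suc (K + ℓ))
-- One-line notation `ℓ, 0, 1, …, ℓ - 1`; each `lift₀` then puts a fixed point in front.
cycle zero    ℓ = insert Fin.zero (fromℕ ℓ) idₚ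
cycle (suc K) ℓ = lift₀ (cycle K ℓ)

below-zero : ∀ xs → below 0 xs ≡ 0
below-zero xs = cong length (filter-none (_<? 0) (All.universal (λ _ ()) xs))

below-map-suc : ∀ x xs → below (suc x) (map suc xs) ≡ below x xs
below-map-suc x []       = refl
below-map-suc x (y ∷ xs) = go (y <? x)
  where
  ih = below-map-suc x xs
  go : Dec (y < x) → below (suc x) (map suc (y ∷ xs)) ≡ below x (y ∷ xs)
  go (yes y<x) = trans (below-< (map suc xs) (s≤s y<x)) (trans (cong suc ih) (sym (below-< xs y<x)))
  go (no y≮x)  = trans (below-≮ (map suc xs) (y≮x ∘ s≤s⁻¹)) (trans ih (sym (below-≮ xs y≮x)))

code-map-suc : ∀ xs → code (map suc xs) ≡ code xs
code-map-suc []       = refl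
code-map-suc (x ∷ xs) = cong₂ _∷_ (below-map-suc x xs) (code-map-suc xs)

code-zero∷map-suc : ∀ xs → code (0 ∷ map suc xs) ≡ 0 ∷ code xs
code-zero∷map-suc xs = cong₂ _∷_ (below-zero (map suc xs)) (code-map-suc xs)

code-identity : ∀ n → code (tabulate {n = n} Fin.toℕ) ≡ replicate n 0
code-identity zero    = refl
code-identity (suc n) = begin
  code (0 ∷ tabulate (suc ∘ Fin.toℕ {n}))  ≡⟨ cong (λ xs → code (0 ∷ xs)) (map-tabulate (Fin.toℕ {n}) suc) ⟨
  code (0 ∷ map suc (tabulate (Fin.toℕ {n}))) ≡⟨ code-zero∷map-suc (tabulate Fin.toℕ) ⟩
  0 ∷ code (tabulate (Fin.toℕ {n}))        ≡⟨ cong (0 ∷_) (code-identity n) ⟩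
  0 ∷ replicate n 0                        ∎
  where open ≡-Reasoning

below-identity : ∀ n → below n (tabulate {n = n} Fin.toℕ) ≡ n
below-identity n = trans
  (cong length (filter-all (_<? n) (Allₚ.tabulate⁺ Finₚ.toℕ<n)))
  (length-tabulate Fin.toℕ)

toℕ-punchIn-fromℕ : ∀ n (k : Fin n) → Fin.toℕ (punchIn (fromℕ n) k) ≡ Fin.toℕ k
toℕ-punchIn-fromℕ (suc n) Fin.zero    = refl
toℕ-punchIn-fromℕ (suc n) (Fin.suc k) = cong suc (toℕ-punchIn-fromℕ n k)

code-cycle : ∀ K ℓ → code (oneLine (cycle K ℓ)) ≡ replicate K 0 ++ ℓ ∷ replicate ℓ 0
code-cycle zero ℓ = begin
  code (oneLine (cycle 0 ℓ))                    ≡⟨ cong code (oneLine-tabulate (cycle 0 ℓ)) ⟩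
  code (Fin.toℕ (fromℕ ℓ) ∷ tabulate (λ k → Fin.toℕ (cycle 0 ℓ ⟨$⟩ʳ Fin.suc k)))
    ≡⟨ cong code (cong₂ _∷_ (Finₚ.toℕ-fromℕ ℓ) (tabulate-cong λ k →
         trans (cong Fin.toℕ (insert-punchIn Fin.zero (fromℕ ℓ) idₚ k)) (toℕ-punchIn-fromℕ ℓ k))) ⟩
  code (ℓ ∷ tabulate (Fin.toℕ {ℓ}))             ≡⟨ cong₂ _∷_ (below-identity ℓ) (code-identity ℓ) ⟩
  ℓ ∷ replicate ℓ 0                             ∎
  where open ≡-Reasoning
code-cycle (suc K) ℓ = begin
  code (oneLine (lift₀ π))                                      ≡⟨ cong code (oneLine-tabulate (lift₀ π)) ⟩
  code (0 ∷ tabulate (λ k → suc (Fin.toℕ (π ⟨$⟩ʳ k))))          ≡⟨ cong (λ xs → code (0 ∷ xs)) (map-tabulate (λ k → Fin.toℕ (π ⟨$⟩ʳ k)) suc) ⟨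
  code (0 ∷ map suc (tabulate (λ k → Fin.toℕ (π ⟨$⟩ʳ k))))      ≡⟨ cong (λ xs → code (0 ∷ map suc xs)) (oneLine-tabulate π) ⟨
  code (0 ∷ map suc (oneLine π))                                ≡⟨ code-zero∷map-suc (oneLine π) ⟩
  0 ∷ code (oneLine π)                                          ≡⟨ cong (0 ∷_) (code-cycle K ℓ) ⟩
  0 ∷ replicate K 0 ++ ℓ ∷ replicate ℓ 0                        ∎
  where
  open ≡-Reasoning
  π = cycle K ℓ

sum-zeros : ∀ n → sum (replicate n 0) ≡ 0
sum-zeros zero    = refl
sum-zeros (suc n) = sum-zeros n

expAt-zeros : ∀ n t → expAt (replicate n 0) t ≡ 0
expAt-zeros zero    t       = refl
expAt-zeros (suc n) zero    = refl
expAt-zeros (suc n) (suc t) = expAt-zeros n t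

sum-hook : ∀ K ℓ m → sum (replicate K 0 ++ ℓ ∷ replicate m 0) ≡ ℓ
sum-hook zero    ℓ m = trans (cong (ℓ +_) (sum-zeros m)) (+-identityʳ ℓ)
sum-hook (suc K) ℓ m = sum-hook K ℓ m

expAt-hook : ∀ K ℓ m → expAt (replicate K 0 ++ ℓ ∷ replicate m 0) K ≡ ℓ
expAt-hook zero    ℓ m = refl
expAt-hook (suc K) ℓ m = expAt-hook K ℓ m

expAt-hook-≢ : ∀ K ℓ m t → t ≢ K → expAt (replicate K 0 ++ ℓ ∷ replicate m 0) t ≡ 0
expAt-hook-≢ zero    ℓ m zero    t≢K = contradiction refl t≢K
expAt-hook-≢ zero    ℓ m (suc t) t≢K = expAt-zeros m t
expAt-hook-≢ (suc K) ℓ m zero    t≢K = refl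
expAt-hook-≢ (suc K) ℓ m (suc t) t≢K = expAt-hook-≢ K ℓ m t (t≢K ∘ cong suc)

sum-code-cycle : ∀ K ℓ → sum (code (oneLine (cycle K ℓ))) ≡ ℓ
sum-code-cycle K ℓ = trans (cong sum (code-cycle K ℓ)) (sum-hook K ℓ ℓ)

len-cycle : ∀ K ℓ → len (cycle K ℓ) ≡ ℓ
len-cycle K ℓ = trans (inversions-code (oneLine (cycle K ℓ))) (sum-code-cycle K ℓ)

schubert-cycle : ∀ K ℓ → IsHook (_≤ᵇ K) (λ _ → 0) ℓ (schubert (cycle K ℓ))
schubert-cycle K ℓ = subst (λ D → IsHook (_≤ᵇ K) (λ _ → 0) D (schubert (cycle K ℓ))) (sum-code-cycle K ℓ)
  -- The largest letter stands at position `K`; without its surplus `ℓ` the code is zero, so the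
  -- monomial factor is 1.
  (schubert-hook (cycle K ℓ) (λ _ → 0) K record
    { δ-max  = refl
    ; before = λ _ t<K → t<K
    ; decr   = λ _ _ → z≤n
    ; c-max  = trans (cong (λ c → expAt c K) (code-cycle K ℓ)) (expAt-hook K ℓ ℓ)
    ; c-rest = λ t t≢K → trans (cong (λ c → expAt c t) (code-cycle K ℓ)) (expAt-hook-≢ K ℓ ℓ t t≢K)
    })

-- Supports and Newton polytopes

coeff-cong : ∀ f {e g} → e ≗ᵉ g → coeff f e ≡ coeff f g
coeff-cong []            e≗g = refl
coeff-cong ((c , x) ∷ f) {e} {g} e≗g = begin
  coeff ((c , x) ∷ f) e                         ≡⟨ coeff-∷ (c , x) f e ⟩
  coeff ((c , x) ∷ []) e ℤ.+ coeff f e          ≡⟨ cong₂ ℤ._+_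
      (indicator-cong (coeff-term c x e) (coeff-term c x g)
        (λ x≗e → pointwise λ t → trans (at x≗e t) (at e≗g t))
        (λ x≗g → pointwise λ t → trans (at x≗g t) (sym (at e≗g t))))
      (coeff-cong f e≗g) ⟩
  coeff ((c , x) ∷ []) g ℤ.+ coeff f g          ≡⟨ coeff-∷ (c , x) f g ⟨
  coeff ((c , x) ∷ f) g                         ∎
  where open ≡-Reasoning

coeff≢0⇒term : ∀ f e → coeff f e ≢ 0ℤ → ∃ λ t → t ∈ f × proj₂ t ≗ᵉ e
coeff≢0⇒term []            e ≢0 = contradiction refl ≢0
coeff≢0⇒term ((c , x) ∷ f) e ≢0 with eqExp x e in eq
... | true  = _ , here refl , eqExp-sound x e eq
... | false = let t , t∈f , t≗e = coeff≢0⇒term f e ≢0 in t , there t∈f , t≗e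

filterPredicate : ∀ {A B : Set} {P : A → Set} {P? : Decidable P} {h : A → B} {ys} xs →
  ys ≡ map h (filter P? xs) → A → Set
filterPredicate {P = P} _ _ = P

-- The predicate selecting the terms of the support uses a function local to Defs.support.
Supported : (f : Poly) → ℤ × Exp → Set
Supported f = filterPredicate {h = proj₂} f (refl {x = support f})

coeff≡1⇒supported : ∀ f t → coeff f (proj₂ t) ≡ 1ℤ → Supported f t
coeff≡1⇒supported f t eq rewrite eq = refl

-- A coefficient ignores trailing zeros but membership in the list `support f` does not, so only
-- some representative `e′` of the monomial is found there.
coeff≡1⇒∈support : ∀ f e → coeff f e ≡ 1ℤ → ∃ λ e′ → e′ ∈ support f × e ≗ᵉ e′
coeff≡1⇒∈support f e eq
  with t , t∈f , t≗e ← coeff≢0⇒term f e (λ ≡0 → case trans (sym eq) ≡0 of λ ()) =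
    proj₂ t
  , ∈-map⁺ proj₂ (∈-filter⁺ _ t∈f (coeff≡1⇒supported f t (trans (coeff-cong f t≗e) eq)))
  , ≗ᵉ-sym t≗e

-- A convex combination sees its vertices only through their entries, so each vertex can be replaced
-- by its representative with the weights kept.
conv-mono : ∀ {S S′} → (∀ e → e ∈ S → ∃ λ e′ → e′ ∈ S′ × e ≗ᵉ e′) → ∀ p → p ∈Conv S → p ∈Conv S′
conv-mono {S} {S′} embed p (comb , ∈S , ≥0 , sum≡1 , p≡) =
  let comb′ , ∈S′ , weights , coords = go comb ∈S in
    comb′ , ∈S′
  , Allₚ.map⁻ (subst (All (0ℚ ℚ.≤_)) weights (Allₚ.map⁺ ≥0))
  , trans (cong sumℚ (sym weights)) sum≡1
  , λ k → trans (p≡ k) (coords k)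
  where
  go : ∀ comb → All (λ t → proj₂ t ∈ S) comb → ∃ λ comb′ → All (λ t → proj₂ t ∈ S′) comb′ ×
    map proj₁ comb ≡ map proj₁ comb′ ×
    (∀ k → sumℚ (map (λ t → proj₁ t ℚ.* ℕtoℚ (expAt (proj₂ t) k)) comb)
         ≡ sumℚ (map (λ t → proj₁ t ℚ.* ℕtoℚ (expAt (proj₂ t) k)) comb′))
  go []               []           = [] , [] , refl , λ _ → refl
  go ((q , e) ∷ comb) (e∈S ∷ ∈S) =
    let comb′ , ∈S′ , weights , coords = go comb ∈S
        e′ , e′∈S′ , e≗e′ = embed e e∈S
    in (q , e′) ∷ comb′ , e′∈S′ ∷ ∈S′ , cong (q ∷_) weights
     , λ k → cong₂ (λ x y → q ℚ.* ℕtoℚ x ℚ.+ y) (at e≗e′ k) (coords k)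

-- The inclusion already holds between the supports, up to trailing zeros: exponents at positions up
-- to `K` are unrestricted in `h`, and those beyond vanish because `n ≤ K`.
⪯D-cycle : ∀ {n K} (u : Permutation′ n) → n ≤ K → u ⪯D cycle K (len u)
⪯D-cycle {n} {K} u n≤K = conv-mono embed
  where
  w = cycle K (len u)
  hookTerm : ∀ e → sum e ≡ len u × (∀ k → n ≤ k → expAt e k ≡ 0) →
    HookTerm (_≤ᵇ K) (λ _ → 0) (len u) e
  hookTerm e (sum≡ , zeros) = (λ t → fits t (t ≤? K)) , sum≡
    where
    fits : ∀ t → Dec (t ≤ K) → Fits (t ≤ᵇ K) 0 (expAt e t)
    fits t (yes t≤K) = subst (λ b → Fits b 0 (expAt e t)) (sym (≤ᵇ-true t≤K)) z≤n
    fits t (no t≰K)  = subst (λ b → Fits b 0 (expAt e t)) (sym (≤ᵇ-false (≰⇒> t≰K)))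
      (zeros t (≤-trans n≤K (<⇒≤ (≰⇒> t≰K))))
  embed : ∀ e → e ∈ support (schubert u) → ∃ λ e′ → e′ ∈ support (schubert w) × e ≗ᵉ e′
  embed e e∈ with t , t∈ , refl ← ∈-map⁻ proj₂ e∈ =
    coeff≡1⇒∈support (schubert w) e (proj₁ (schubert-cycle K (len u) e)
      (hookTerm e (All.lookup (schubert-homogeneous u) (proj₁ (∈-filter⁻ _ t∈)))))

theorem5p12 : (ℓ : ℕ) {m n : ℕ} (u : Permutation′ m) (v : Permutation′ n) →
    len u ≡ ℓ → len v ≡ ℓ →
    Σ ℕ λ k → Σ (Permutation′ k) λ w → len w ≡ ℓ × u ⪯D w × v ⪯D w
theorem5p12 ℓ {m} {n} u v u≡ℓ v≡ℓ =
    suc (K + ℓ) , cycle K ℓ , len-cycle K ℓ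
  , subst (λ l → u ⪯D cycle K l) u≡ℓ (⪯D-cycle u (m≤m⊔n m n))
  , subst (λ l → v ⪯D cycle K l) v≡ℓ (⪯D-cycle v (m≤n⊔m m n))
  where
  -- Large enough for the variables of both polynomials, so a single cycle dominates `u` and `v`.
  K = m ⊔ n
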